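{- Let $q=p^m$ with $p$ prime and $m\ge 1$, let $n\ge1$ with $\gcd(n,p)=1$, and let $Q=q^n$. Let $x^n-1=p_1(x)p_2(x)\cdots p_s(x)$ be the decomposition of $x^n-1$ into distinct monic irreducible polynomials in $\mathbb{F}_q[x]$, and let the idempotents $e_i(x)$ $(1\le i\le s)$ of $\mathbb{F}_q[x]/(x^n-1)$ be determined by $$e_i(x)\equiv\delta_{ij}\pmod{p_j(x)}\qquad(1\le j\le s),$$ where $\delta_{ij}=1$ if $i=j$ and $\delta_{ij}=0$ otherwise. Let $E_i(x)=\varphi(e_i(x))$ and $P_i(x)=\varphi(p_i(x))$ $(1\le i\le s)$. For any $\alpha\in\mathbb{F}_Q^\times$, let $$\Delta=\Delta(\alpha)=\{i:1\le i\le s,\ E_i(\alpha)\neq 0\}.$$ Then the minimal $q$-polynomial of $\alpha$ is $M_\Delta(x)=\bigotimes_{i\in\Delta}P_i(x)$, and $\alpha$ is a $k$-normal element for the extension $\mathbb{F}_Q/\mathbb{F}_q$, where $k=n-\sum_{i\in\Delta}\deg p_i(x)$.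
   Context: $\mathbb{F}_Q^\times=\mathbb{F}_Q\setminus\{0\}$. For $0\le k\le n-1$, an element $\alpha\in\mathbb{F}_Q^\times$ is called a $k$-normal element for $\mathbb{F}_Q/\mathbb{F}_q$ if $\gcd(g_\alpha(x),x^n-1)$ has degree $k$, where $g_\alpha(x)=\sum_{i=0}^{n-1}\alpha^{q^i}x^{n-i-1}$. A $q$-polynomial is a polynomial $\sum_{i=0}^m a_i x^{q^i}$ with $a_i\in\mathbb{F}_q$; the set $\mathcal{F}_q[x]$ of all $q$-polynomials is a ring under ordinary addition and the multiplication $L(x)\otimes K(x)=L(K(x))$ (composition). The map $\varphi:\mathbb{F}_q[x]\to\mathcal{F}_q[x]$, $\sum_i a_i x^i\mapsto\sum_i a_i x^{q^i}$, is a ring isomorphism, so $\mathcal{F}_q[x]$ is a principal ideal domain with identity $x$ (and $\bigotimes$ denotes a product in this commutative ring). For $\alpha\in\mathbb{F}_Q^\times$, the set $I_\alpha=\{M(x)\in\mathcal{F}_q[x]: M(\alpha)=0\}$ is a nonzero ideal of $\mathcal{F}_q[x]$, and its monic generator is called the minimal $q$-polynomial of $\alpha$. The element $e_i(x)$ is a class modulo $x^n-1$; when applying $\varphi$ one uses a polynomial representative, e.g. the one of degree less than $n$ (the value $E_i(\alpha)$ for $\alpha\in\mathbb{F}_Q$ does not depend on the representative). -}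

module Defs where

open import Level using (Level; _⊔_; suc)
open import Algebra.Bundles.Raw using (RawRing)
open import Algebra.Apartness.Bundles using (HeytingCommutativeRing; HeytingField)
open import Algebra.Bundles using (CommutativeRing)
import Algebra.Definitions.RawSemiring as RawSemiringDefinitions
open import Algebra.Morphism.Structures using (IsRingMonomorphism)
open import Data.Bool.Base using (if_then_else_)
open import Data.Fin.Base using (Fin; toℕ)
open import Data.Fin.Properties using (inj⇒≟) renaming (_≟_ to _≟ᶠ_)
open import Data.Fin.Subset using (Subset; inside; outside)
open import Data.List.Base as List using (List; []; _∷_)
open import Data.Nat.Base as ℕ using (ℕ; zero; _∸_)
open import Data.Product.Base using (_×_; ∃-syntax)
open import Data.Vec.Base as Vec using ([]; _∷_)
open import Data.Vec.Functional as Vector using (Vector)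
open import Function.Bundles using (Bijection)
open import Relation.Binary.Definitions using (Decidable)
open import Relation.Binary.PropositionalEquality.Properties as ≡ using ()
open import Relation.Nullary.Decidable.Core using (does; ¬?)
open import Relation.Unary using (Pred; _∈_; _≐_)

private
  variable
    a b c c′ ℓ ℓ₁ ℓ₂ ℓ₁′ ℓ₂′ : Level

module Polynomials (R : RawRing c ℓ) where

  open RawRing R

  -- Coefficient lists, constant term first.  Trailing zeros are allowed,
  -- so equality is coefficientwise and not equality of lists.
  Poly : Set c
  Poly = List Carrier

  coeff : Poly → ℕ → Carrier
  coeff []      _         = 0#
  coeff (a ∷ f) zero      = a
  coeff (a ∷ f) (ℕ.suc i) = coeff f i

  infix 4 _≈ₚ_

  record _≈ₚ_ (f g : Poly) : Set ℓ where
    constructor mk≈ₚ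
    field
      coeff-≈ : ∀ i → coeff f i ≈ coeff g i

  infixl 6 _+ₚ_
  infixl 7 _*ₚ_

  _+ₚ_ : Poly → Poly → Poly
  []      +ₚ g       = g
  (a ∷ f) +ₚ []      = a ∷ f
  (a ∷ f) +ₚ (b ∷ g) = (a + b) ∷ (f +ₚ g)

  _*ₚ_ : Poly → Poly → Poly
  []      *ₚ g = []
  (a ∷ f) *ₚ g = List.map (a *_) g +ₚ (0# ∷ (f *ₚ g))

  const : Carrier → Poly
  const a = a ∷ []

  X : Poly
  X = 0# ∷ 1# ∷ []

  polynomialRing : RawRing c ℓ
  polynomialRing = record
    { Carrier = Poly
    ; _≈_     = _≈ₚ_
    ; _+_     = _+ₚ_
    ; _*_     = _*ₚ_
    ; -_      = List.map (-_)
    ; 0#      = []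
    ; 1#      = const 1#
    }

  private
    module P where
      open RawRing polynomialRing public
      open RawSemiringDefinitions (RawRing.rawSemiring polynomialRing) public
        using (_^_; _∣_)

  monomial : Carrier → ℕ → Poly
  monomial a k = const a P.* X P.^ k

  Xⁿ-1 : ℕ → Poly
  Xⁿ-1 n = X P.^ n P.+ P.- P.1#

  eval : Poly → Carrier → Carrier
  eval []      x = 0#
  eval (a ∷ f) x = a + x * eval f x

  infixr 9 _∘ₚ_

  _∘ₚ_ : Poly → Poly → Poly
  []      ∘ₚ g = P.0#
  (a ∷ f) ∘ₚ g = const a P.+ g P.* (f ∘ₚ g)

  HasDegree : Poly → ℕ → Set ℓ
  HasDegree f d = coeff f d ≉ 0# × (∀ i → d ℕ.< i → coeff f i ≈ 0#)

  Monic : Poly → Set ℓ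
  Monic f = ∃[ d ] HasDegree f d × coeff f d ≈ 1#

  infix 4 _≡_[mod_]

  _≡_[mod_] : Poly → Poly → Poly → Set (c ⊔ ℓ)
  f ≡ g [mod h ] = h P.∣ f P.+ P.- g

  record IsGCD (f g d : Poly) : Set (c ⊔ ℓ) where
    field
      monic    : Monic d
      divides₁ : d P.∣ f
      divides₂ : d P.∣ g
      greatest : ∀ h → h P.∣ f → h P.∣ g → h P.∣ d

  δ : ∀ {s} → Fin s → Fin s → Poly
  δ i j = if does (i ≟ᶠ j) then P.1# else P.0#

-- For a finite carrier the apartness relation of a Heyting field carries no
-- extra information: equality and invertibility are decidable, and x # y is
-- equivalent to x ≉ y, so this is an ordinary field with q elements.
record FiniteField c ℓ₁ ℓ₂ (q : ℕ) : Set (suc (c ⊔ ℓ₁ ⊔ ℓ₂)) where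
  field
    heytingField : HeytingField c ℓ₁ ℓ₂

  open HeytingField heytingField public

  open HeytingCommutativeRing heytingCommutativeRing public
    using (commutativeRing)
  open CommutativeRing commutativeRing public using (rawRing; _≉_)

  field
    enumeration : Bijection setoid (≡.setoid (Fin q))

  infix 4 _≟_

  _≟_ : Decidable _≈_
  _≟_ = inj⇒≟ (Bijection.injection enumeration)

record FieldExtension {q Q} (K : FiniteField c ℓ₁ ℓ₂ q)
                      (L : FiniteField c′ ℓ₁′ ℓ₂′ Q)
                      : Set (c ⊔ ℓ₁ ⊔ c′ ⊔ ℓ₁′) where
  private
    module K = FiniteField K
    module L = FiniteField L

  field
    ι                  : K.Carrier → L.Carrier
    isRingMonomorphism : IsRingMonomorphism K.rawRing L.rawRing ι

foldOver : {A : Set a} {B : Set b} → (A → B → B) → B →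
           ∀ {s} → Subset s → Vector A s → B
foldOver _∙_ ε []            v = ε
foldOver _∙_ ε (inside  ∷ S) v = Vector.head v ∙ foldOver _∙_ ε S (Vector.tail v)
foldOver _∙_ ε (outside ∷ S) v = foldOver _∙_ ε S (Vector.tail v)

infix 5 ∑[_]_

∑[_]_ : ∀ {s} → Subset s → Vector ℕ s → ℕ
∑[ S ] d = foldOver ℕ._+_ 0 S d

module Extension {q Q} {K : FiniteField c ℓ₁ ℓ₂ q} {L : FiniteField c′ ℓ₁′ ℓ₂′ Q}
                 (E : FieldExtension K L) where

  open FieldExtension E

  module K where
    open FiniteField K public
    open Polynomials rawRing public

  module L where
    open FiniteField L public
    open Polynomials rawRing public

  module K[x] where
    open RawRing K.polynomialRing public
    open RawSemiringDefinitions (RawRing.rawSemiring K.polynomialRing) public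
      using (sum; product; Irreducible)

  private
    module L[x] = RawSemiringDefinitions (RawRing.rawSemiring L.polynomialRing)
    open RawSemiringDefinitions (RawRing.rawSemiring L.rawRing) using (_^_)

  infix 10 _⟨_⟩

  _⟨_⟩ : K.Poly → L.Carrier → L.Carrier
  f ⟨ α ⟩ = L.eval (List.map ι f) α

  φ : K.Poly → K.Poly
  φ f = K[x].sum (λ i → K.monomial (List.lookup f i) (q ℕ.^ toℕ i))

  𝓕 : Pred K.Poly (c ⊔ ℓ₁)
  𝓕 M = ∃[ f ] M K.≈ₚ φ f

  infixl 7 _⊗_

  _⊗_ : K.Poly → K.Poly → K.Poly
  M ⊗ N = M K.∘ₚ N

  infix 5 ⨂[_]_

  -- The identity of ⊗, hence the empty product, is x.
  ⨂[_]_ : ∀ {s} → Subset s → Vector K.Poly s → K.Poly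
  ⨂[ S ] P = foldOver _⊗_ K.X S P

  I : L.Carrier → Pred K.Poly (c ⊔ ℓ₁ ⊔ ℓ₁′)
  I α M = M ∈ 𝓕 × M ⟨ α ⟩ L.≈ L.0#

  -- One side suffices, as ⊗ is commutative on 𝓕.
  PrincipalIdeal : K.Poly → Pred K.Poly (c ⊔ ℓ₁)
  PrincipalIdeal M N = ∃[ H ] H ∈ 𝓕 × N K.≈ₚ H ⊗ M

  record IsMinimalQPolynomial (α : L.Carrier) (M : K.Poly) : Set (c ⊔ ℓ₁ ⊔ ℓ₁′) where
    field
      monic       : K.Monic M
      qPolynomial : M ∈ 𝓕
      generates   : I α ≐ PrincipalIdeal M

  -- Each e i is a representative of a class modulo xⁿ - 1; when Q = qⁿ the
  -- value φ (e i) ⟨ α ⟩ does not depend on its choice.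
  Δ : ∀ {s} → Vector K.Poly s → L.Carrier → Subset s
  Δ e α = Vec.tabulate (λ i → does (¬? (φ (e i) ⟨ α ⟩ L.≟ L.0#)))

  g : ℕ → L.Carrier → L.Poly
  g n α = L[x].sum {n} (λ i → L.monomial (α ^ (q ℕ.^ toℕ i)) (n ∸ toℕ i ∸ 1))

  -- n is the degree of the extension, that is, Q = qⁿ.
  record IsNormal (n k : ℕ) (α : L.Carrier) : Set (c′ ⊔ ℓ₁′) where
    field
      nonzero    : α L.≉ L.0#
      k<n        : k ℕ.< n
      gcd-degree : ∃[ d ] L.IsGCD (g n α) (L.Xⁿ-1 n) d × L.HasDegree d k

{-# OPTIONS --safe #-}

-- Write σ for the q-power map.  K[x] acts on L by f ⊙ β = Σ fᵢ σⁱ(β) = φ(f)(β),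
-- and on itself in the same way, with f ⊙ x = φ(f) and f ⊙ h = φ(f) ∘ h; hence
-- φ(f h) = φ(f) ∘ φ(h), and the minimal q-polynomial of α is φ of the generator
-- of the annihilator of α.  That generator is m = ∏_{i ∈ Δ} pᵢ: it kills α
-- because xⁿ - 1 divides every pᵢ eᵢ and kills L, and conversely if f kills α
-- and i ∈ Δ, then f is not coprime to pᵢ, as both kill eᵢ ⊙ α ≠ 0.
--
-- For the gcd, g = (xⁿ - 1) Σ σⁱ(α) x⁻ⁱ⁻¹, so for h in L[x], xⁿ - 1 divides h g
-- exactly when Σ hᵢ σⁱ⁺ʲ(α) = 0 for all j.  These h form a σ-stable ideal, which
-- by Galois descent is generated over K, that is, by m.  Hence
-- gcd(g, xⁿ - 1) = (xⁿ - 1) / m.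

module Submission where

open import Defs
open import Algebra.Bundles using (AbelianGroup; CommutativeRing)
open import Algebra.Definitions.RawMagma using () renaming (_,_ to _,∣_)
import Algebra.Definitions.RawSemiring as RawSemiringDefinitions
open import Algebra.Morphism.Structures using (IsRingHomomorphism; IsRingMonomorphism)
import Algebra.Properties.CommutativeMonoid.Sum as CommutativeMonoidSum
import Algebra.Properties.CommutativeSemigroup as CommutativeSemigroupProperties
import Algebra.Properties.CommutativeSemiring.Binomial as Binomial
import Algebra.Properties.CommutativeSemiring.Exp as CommutativeExp
import Algebra.Properties.Group as GroupProperties
import Algebra.Properties.Ring as RingProperties
import Algebra.Properties.Semiring.Divisibility as SemiringDivisibility
import Algebra.Properties.Semiring.Exp as Exp
import Algebra.Properties.Semiring.Mult as Mult
import Algebra.Properties.Semiring.Sum as Sum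
import Algebra.Solver.Ring.NaturalCoefficients.Default as SemiringSolver
open import Data.Fin.Base using (Fin; zero; suc; toℕ; inject₁; fromℕ)
open import Data.Fin.Permutation using (Permutation′; permutation; _⟨$⟩ʳ_)
import Data.Fin.Properties as Fin
open import Data.Fin.Subset using (Subset; _∈_; inside; outside; ⊤)
open import Data.Fin.Subset.Properties using (∈⊤)
import Data.Integer.Base as ℤ
open import Data.Integer.Base using (+_)
import Data.Integer.Properties as ℤ
open import Data.List.Base as List using ([]; _∷_; length; take)
import Data.List.Properties as List
open import Data.Nat.Base as ℕ using (ℕ; zero; suc; _≤_; _<_; s≤s; z≤n; _!; _∸_)
open import Data.Nat.Combinatorics using (_C_; nCn≡1; nCk≡n!/k![n-k]!; k![n∸k]!∣n!)
import Data.Nat.Divisibility as ℕ∣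
open import Data.Nat.DivMod using (m/n*n≡m)
open import Data.Nat.Primality
  using (Prime; ¬prime[0]; euclidsLemma; prime⇒nonTrivial; prime⇒nonZero)
import Data.Nat.Properties as ℕ
open import Data.Product.Base using (_,_; _×_; ∃-syntax; ∃₂; proj₁; proj₂)
open import Data.Sum.Base using (_⊎_; inj₁; inj₂)
open import Data.Vec.Base using ([]; _∷_; here; there)
open import Data.Vec.Functional using (Vector; removeAt; replicate)
import Data.Vec.Properties as Vec
open import Function.Base using (_∘_)
open import Function.Bundles using (Bijection)
open import Level using (_⊔_)
open import Relation.Binary.Bundles using (Setoid)
open import Relation.Binary.Definitions using (Decidable; tri<; tri≈; tri>)
open import Relation.Binary.PropositionalEquality as ≡ using (_≡_; _≢_)
import Relation.Binary.Reasoning.Setoid as SetoidReasoning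
open import Relation.Nullary.Decidable using (Dec; yes; no; ¬?; dec-true; dec-false)
open import Relation.Nullary.Negation using (¬_; contradiction)
import Relation.Unary as Unary

-- The gcd is taken over L, where the `𝐩 i` may factor further, so a divisor of xⁿ - 1 in L[x] need
-- not come from K; this gap is what descent has to bridge. Descent rests on two facts. The map σ is
-- a ring endomorphism, because p · 1 = 0 removes the middle binomial terms. Every element of L
-- fixed by σ lies in the image of `ι`, because xᵠ - x cannot have q + 1 roots. The law (f g) ⊙ β =
-- f ⊙ (g ⊙ β) needs the coefficients of g to be fixed by σ, since σ has to pass them. It holds for
-- g from K but not for all g in L[x], so over L the vanishing condition is imposed on all
-- conjugates of α at once; that makes the annihilating polynomials an ideal. Comaximality of the
-- `𝐩 i` is read off the idempotents: for i ≠ j, `𝐩 i` divides 1 - `e i` and `𝐩 j` divides `e i`,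
-- and the two multiples add up to 1.

-- The ring of polynomials and their evaluation

module PolynomialRing {c ℓ} (R : CommutativeRing c ℓ) where

  open CommutativeRing R hiding (zero)
  open Polynomials rawRing
  open RingProperties ring using (-0#≈0#)

  ≈ₚ-setoid : Setoid c ℓ
  ≈ₚ-setoid = record
    { Carrier       = Poly
    ; _≈_           = _≈ₚ_
    ; isEquivalence = record
      { refl  = mk≈ₚ λ i → refl
      ; sym   = λ (mk≈ₚ e) → mk≈ₚ λ i → sym (e i)
      ; trans = λ (mk≈ₚ e) (mk≈ₚ e′) → mk≈ₚ λ i → trans (e i) (e′ i)
      }
    }

  private
    module S = Setoid ≈ₚ-setoid

  open _≈ₚ_ public

  infixr 7 _·_

  _·_ : Carrier → Poly → Poly
  a · f = List.map (a *_) f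

  coeff-+ : ∀ f g i → coeff (f +ₚ g) i ≈ coeff f i + coeff g i
  coeff-+ []      g       i       = sym (+-identityˡ _)
  coeff-+ (a ∷ f) []      i       = sym (+-identityʳ _)
  coeff-+ (a ∷ f) (b ∷ g) zero    = refl
  coeff-+ (a ∷ f) (b ∷ g) (suc i) = coeff-+ f g i

  coeff-· : ∀ a f i → coeff (a · f) i ≈ a * coeff f i
  coeff-· a []      i       = sym (zeroʳ a)
  coeff-· a (b ∷ f) zero    = refl
  coeff-· a (b ∷ f) (suc i) = coeff-· a f i

  coeff-neg : ∀ f i → coeff (List.map (-_) f) i ≈ - coeff f i
  coeff-neg []      i       = sym -0#≈0#
  coeff-neg (b ∷ f) zero    = refl
  coeff-neg (b ∷ f) (suc i) = coeff-neg f i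

  ∷-cong : ∀ {a b f g} → a ≈ b → f ≈ₚ g → a ∷ f ≈ₚ b ∷ g
  ∷-cong p (mk≈ₚ e) = mk≈ₚ λ { zero → p ; (suc i) → e i }

  0∷[]≈[] : 0# ∷ [] ≈ₚ []
  0∷[]≈[] = mk≈ₚ λ { zero → refl ; (suc i) → refl }

  ∷-zero : ∀ {a f} → a ≈ 0# → f ≈ₚ [] → a ∷ f ≈ₚ []
  ∷-zero p e = S.trans (∷-cong p e) 0∷[]≈[]

  +ₚ-cong : ∀ {f f′ g g′} → f ≈ₚ f′ → g ≈ₚ g′ → f +ₚ g ≈ₚ f′ +ₚ g′
  +ₚ-cong {f} {f′} {g} {g′} (mk≈ₚ p) (mk≈ₚ q) = mk≈ₚ λ i →
    trans (coeff-+ f g i) (trans (+-cong (p i) (q i)) (sym (coeff-+ f′ g′ i)))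

  +ₚ-assoc : ∀ f g h → (f +ₚ g) +ₚ h ≈ₚ f +ₚ (g +ₚ h)
  +ₚ-assoc f g h = mk≈ₚ λ i → begin
    coeff ((f +ₚ g) +ₚ h) i             ≈⟨ trans (coeff-+ (f +ₚ g) h i) (+-congʳ (coeff-+ f g i)) ⟩
    coeff f i + coeff g i + coeff h i   ≈⟨ +-assoc _ _ _ ⟩
    coeff f i + (coeff g i + coeff h i) ≈⟨ trans (coeff-+ f (g +ₚ h) i) (+-congˡ (coeff-+ g h i)) ⟨
    coeff (f +ₚ (g +ₚ h)) i             ∎
    where open SetoidReasoning setoid

  +ₚ-comm : ∀ f g → f +ₚ g ≈ₚ g +ₚ f
  +ₚ-comm f g = mk≈ₚ λ i →
    trans (coeff-+ f g i) (trans (+-comm _ _) (sym (coeff-+ g f i)))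

  +ₚ-identityʳ : ∀ f → f +ₚ [] ≈ₚ f
  +ₚ-identityʳ f = +ₚ-comm f []

  +ₚ-inverseʳ : ∀ f → f +ₚ List.map (-_) f ≈ₚ []
  +ₚ-inverseʳ f = mk≈ₚ λ i →
    trans (coeff-+ f _ i) (trans (+-congˡ (coeff-neg f i)) (-‿inverseʳ _))

  -ₚ-cong : ∀ {f g} → f ≈ₚ g → List.map (-_) f ≈ₚ List.map (-_) g
  -ₚ-cong {f} {g} (mk≈ₚ e) = mk≈ₚ λ i →
    trans (coeff-neg f i) (trans (-‿cong (e i)) (sym (coeff-neg g i)))

  +ₚ-interchange : ∀ f g h k → (f +ₚ g) +ₚ (h +ₚ k) ≈ₚ (f +ₚ h) +ₚ (g +ₚ k)
  +ₚ-interchange = CommutativeSemigroupProperties.interchange record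
    { isCommutativeSemigroup = record
      { isSemigroup = record
        { isMagma = record { isEquivalence = S.isEquivalence ; ∙-cong = +ₚ-cong }
        ; assoc   = +ₚ-assoc
        }
      ; comm = +ₚ-comm
      }
    }

  ·-cong : ∀ {a b f g} → a ≈ b → f ≈ₚ g → a · f ≈ₚ b · g
  ·-cong {a} {b} {f} {g} p (mk≈ₚ e) = mk≈ₚ λ i →
    trans (coeff-· a f i) (trans (*-cong p (e i)) (sym (coeff-· b g i)))

  ·-distribˡ : ∀ a f g → a · (f +ₚ g) ≈ₚ a · f +ₚ a · g
  ·-distribˡ a f g = mk≈ₚ λ i → begin
    coeff (a · (f +ₚ g)) i            ≈⟨ trans (coeff-· a (f +ₚ g) i) (*-congˡ (coeff-+ f g i)) ⟩
    a * (coeff f i + coeff g i)       ≈⟨ distribˡ a _ _ ⟩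
    a * coeff f i + a * coeff g i     ≈⟨ +-cong (coeff-· a f i) (coeff-· a g i) ⟨
    coeff (a · f) i + coeff (a · g) i ≈⟨ coeff-+ (a · f) (a · g) i ⟨
    coeff (a · f +ₚ a · g) i          ∎
    where open SetoidReasoning setoid

  ·-distribʳ : ∀ a b f → (a + b) · f ≈ₚ a · f +ₚ b · f
  ·-distribʳ a b f = mk≈ₚ λ i → begin
    coeff ((a + b) · f) i             ≈⟨ coeff-· (a + b) f i ⟩
    (a + b) * coeff f i               ≈⟨ distribʳ _ a b ⟩
    a * coeff f i + b * coeff f i     ≈⟨ +-cong (coeff-· a f i) (coeff-· b f i) ⟨
    coeff (a · f) i + coeff (b · f) i ≈⟨ coeff-+ (a · f) (b · f) i ⟨
    coeff (a · f +ₚ b · f) i          ∎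
    where open SetoidReasoning setoid

  ·-assoc : ∀ a b f → (a * b) · f ≈ₚ a · (b · f)
  ·-assoc a b f = mk≈ₚ λ i → begin
    coeff ((a * b) · f) i   ≈⟨ coeff-· (a * b) f i ⟩
    a * b * coeff f i       ≈⟨ *-assoc a b _ ⟩
    a * (b * coeff f i)     ≈⟨ *-congˡ (coeff-· b f i) ⟨
    a * coeff (b · f) i     ≈⟨ coeff-· a (b · f) i ⟨
    coeff (a · (b · f)) i   ∎
    where open SetoidReasoning setoid

  ·-identity : ∀ f → 1# · f ≈ₚ f
  ·-identity f = mk≈ₚ λ i → trans (coeff-· 1# f i) (*-identityˡ _)

  ·-zero : ∀ f → 0# · f ≈ₚ []
  ·-zero f = mk≈ₚ λ i → trans (coeff-· 0# f i) (zeroˡ _)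

  0∷-+ₚ : ∀ f g → 0# ∷ (f +ₚ g) ≈ₚ (0# ∷ f) +ₚ (0# ∷ g)
  0∷-+ₚ f g = ∷-cong (sym (+-identityˡ 0#)) S.refl

  private
    open module ≈ₚ-Reasoning = SetoidReasoning ≈ₚ-setoid

  *ₚ-zeroʳ : ∀ f → f *ₚ [] ≈ₚ []
  *ₚ-zeroʳ []      = S.refl
  *ₚ-zeroʳ (a ∷ f) = ∷-zero refl (*ₚ-zeroʳ f)

  *ₚ-distribʳ : ∀ h f g → (f +ₚ g) *ₚ h ≈ₚ f *ₚ h +ₚ g *ₚ h
  *ₚ-distribʳ h []      g       = S.refl
  *ₚ-distribʳ h (a ∷ f) []      = S.sym (+ₚ-identityʳ _)
  *ₚ-distribʳ h (a ∷ f) (b ∷ g) = begin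
    (a + b) · h +ₚ (0# ∷ (f +ₚ g) *ₚ h)
      ≈⟨ +ₚ-cong (·-distribʳ a b h) (S.trans (∷-cong refl (*ₚ-distribʳ h f g)) (0∷-+ₚ (f *ₚ h) (g *ₚ h))) ⟩
    (a · h +ₚ b · h) +ₚ ((0# ∷ f *ₚ h) +ₚ (0# ∷ g *ₚ h))
      ≈⟨ +ₚ-interchange (a · h) (b · h) (0# ∷ f *ₚ h) (0# ∷ g *ₚ h) ⟩
    (a · h +ₚ (0# ∷ f *ₚ h)) +ₚ (b · h +ₚ (0# ∷ g *ₚ h)) ∎

  -- Mirror image of the defining recursion on the left factor; it is the inductive step of
  -- commutativity.
  *ₚ-∷ : ∀ f b g → f *ₚ (b ∷ g) ≈ₚ b · f +ₚ (0# ∷ f *ₚ g)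
  *ₚ-∷ []      b g = S.sym 0∷[]≈[]
  *ₚ-∷ (a ∷ f) b g = ∷-cong (+-congʳ (*-comm a b)) (begin
    a · g +ₚ f *ₚ (b ∷ g)              ≈⟨ +ₚ-cong S.refl (*ₚ-∷ f b g) ⟩
    a · g +ₚ (b · f +ₚ (0# ∷ f *ₚ g))  ≈⟨ +ₚ-assoc (a · g) (b · f) _ ⟨
    (a · g +ₚ b · f) +ₚ (0# ∷ f *ₚ g)  ≈⟨ +ₚ-cong (+ₚ-comm (a · g) (b · f)) S.refl ⟩
    (b · f +ₚ a · g) +ₚ (0# ∷ f *ₚ g)  ≈⟨ +ₚ-assoc (b · f) (a · g) _ ⟩
    b · f +ₚ (a · g +ₚ (0# ∷ f *ₚ g))  ∎)

  *ₚ-comm : ∀ f g → f *ₚ g ≈ₚ g *ₚ f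
  *ₚ-comm f []      = *ₚ-zeroʳ f
  *ₚ-comm f (b ∷ g) =
    S.trans (*ₚ-∷ f b g) (+ₚ-cong S.refl (∷-cong refl (*ₚ-comm f g)))

  *ₚ-congˡ : ∀ f {g g′} → g ≈ₚ g′ → f *ₚ g ≈ₚ f *ₚ g′
  *ₚ-congˡ []      e = S.refl
  *ₚ-congˡ (a ∷ f) e = +ₚ-cong (·-cong refl e) (∷-cong refl (*ₚ-congˡ f e))

  *ₚ-cong : ∀ {f f′ g g′} → f ≈ₚ f′ → g ≈ₚ g′ → f *ₚ g ≈ₚ f′ *ₚ g′
  *ₚ-cong {f} {f′} {g} {g′} p q = begin
    f *ₚ g    ≈⟨ *ₚ-congˡ f q ⟩
    f *ₚ g′   ≈⟨ *ₚ-comm f g′ ⟩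
    g′ *ₚ f   ≈⟨ *ₚ-congˡ g′ p ⟩
    g′ *ₚ f′  ≈⟨ *ₚ-comm g′ f′ ⟩
    f′ *ₚ g′  ∎

  0∷-*ₚ : ∀ f h → (0# ∷ f) *ₚ h ≈ₚ 0# ∷ f *ₚ h
  0∷-*ₚ f h = +ₚ-cong (·-zero h) S.refl

  ·-*ₚ-assoc : ∀ a g h → (a · g) *ₚ h ≈ₚ a · (g *ₚ h)
  ·-*ₚ-assoc a []      h = S.refl
  ·-*ₚ-assoc a (b ∷ g) h = begin
    (a * b) · h +ₚ (0# ∷ (a · g) *ₚ h)
      ≈⟨ +ₚ-cong (·-assoc a b h) (∷-cong (sym (zeroʳ a)) (·-*ₚ-assoc a g h)) ⟩
    a · (b · h) +ₚ a · (0# ∷ g *ₚ h)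
      ≈⟨ ·-distribˡ a (b · h) (0# ∷ g *ₚ h) ⟨
    a · (b · h +ₚ (0# ∷ g *ₚ h)) ∎

  *ₚ-assoc : ∀ f g h → (f *ₚ g) *ₚ h ≈ₚ f *ₚ (g *ₚ h)
  *ₚ-assoc []      g h = S.refl
  *ₚ-assoc (a ∷ f) g h = begin
    (a · g +ₚ (0# ∷ f *ₚ g)) *ₚ h
      ≈⟨ *ₚ-distribʳ h (a · g) _ ⟩
    (a · g) *ₚ h +ₚ (0# ∷ f *ₚ g) *ₚ h
      ≈⟨ +ₚ-cong (·-*ₚ-assoc a g h) (S.trans (0∷-*ₚ (f *ₚ g) h) (∷-cong refl (*ₚ-assoc f g h))) ⟩
    a · (g *ₚ h) +ₚ (0# ∷ f *ₚ (g *ₚ h)) ∎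

  const-*ₚ : ∀ a f → const a *ₚ f ≈ₚ a · f
  const-*ₚ a f = S.trans (+ₚ-cong S.refl 0∷[]≈[]) (+ₚ-identityʳ _)

  *ₚ-identityˡ : ∀ f → const 1# *ₚ f ≈ₚ f
  *ₚ-identityˡ f = S.trans (const-*ₚ 1# f) (·-identity f)

  X-*ₚ : ∀ f → X *ₚ f ≈ₚ 0# ∷ f
  X-*ₚ f = S.trans (0∷-*ₚ (const 1#) f) (∷-cong refl (*ₚ-identityˡ f))

  polyRing : CommutativeRing c ℓ
  polyRing = record
    { Carrier = Poly
    ; _≈_     = _≈ₚ_
    ; _+_     = _+ₚ_
    ; _*_     = _*ₚ_
    ; -_      = List.map (-_)
    ; 0#      = []
    ; 1#      = const 1#
    ; isCommutativeRing = record
      { isRing = record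
        { +-isAbelianGroup = record
          { isGroup = record
            { isMonoid = record
              { isSemigroup = record
                { isMagma = record { isEquivalence = S.isEquivalence ; ∙-cong = +ₚ-cong }
                ; assoc   = +ₚ-assoc
                }
              ; identity = (λ f → S.refl) , +ₚ-identityʳ
              }
            ; inverse = (λ f → S.trans (+ₚ-comm _ f) (+ₚ-inverseʳ f)) , +ₚ-inverseʳ
            ; ⁻¹-cong = -ₚ-cong
            }
          ; comm = +ₚ-comm
          }
        ; *-cong     = *ₚ-cong
        ; *-assoc    = *ₚ-assoc
        ; *-identity = *ₚ-identityˡ , λ f → S.trans (*ₚ-comm f _) (*ₚ-identityˡ f)
        ; distrib    = (λ f g h → S.trans (*ₚ-comm f _)
                          (S.trans (*ₚ-distribʳ f g h) (+ₚ-cong (*ₚ-comm g f) (*ₚ-comm h f))))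
                     , *ₚ-distribʳ
        }
      ; *-comm = *ₚ-comm
      }
    }

  -- `≈ₚ` ignores trailing zeros while `eval` recurses on the list, so lists of different lengths
  -- have to be compared; in `eval-cong` that comparison ends in this case.
  eval-zero : ∀ {f} x → f ≈ₚ [] → eval f x ≈ 0#
  eval-zero {[]}    x e        = refl
  eval-zero {a ∷ f} x (mk≈ₚ e) = trans
    (+-cong (e 0) (trans (*-congˡ (eval-zero {f} x (mk≈ₚ λ i → e (suc i)))) (zeroʳ x)))
    (+-identityˡ 0#)

  eval-cong : ∀ {f g x y} → f ≈ₚ g → x ≈ y → eval f x ≈ eval g y
  eval-cong {[]}    {g}     {x} {y} e _        = sym (eval-zero y (S.sym e))
  eval-cong {a ∷ f} {[]}    {x} {y} e _        = eval-zero x e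
  eval-cong {a ∷ f} {b ∷ g} (mk≈ₚ e) p =
    +-cong (e 0) (*-cong p (eval-cong {f} {g} (mk≈ₚ λ i → e (suc i)) p))

  module _ (x : Carrier) where

    open CommutativeSemigroupProperties (CommutativeRing.+-commutativeSemigroup R)
      using (interchange)
    open CommutativeSemigroupProperties (CommutativeRing.*-commutativeSemigroup R)
      using () renaming (x∙yz≈y∙xz to x*yz≈y*xz)

    eval-+ : ∀ f g → eval (f +ₚ g) x ≈ eval f x + eval g x
    eval-+ []      g       = sym (+-identityˡ _)
    eval-+ (a ∷ f) []      = sym (+-identityʳ _)
    eval-+ (a ∷ f) (b ∷ g) = trans
      (+-congˡ (trans (*-congˡ (eval-+ f g)) (distribˡ x _ _)))
      (interchange a b _ _)

    eval-· : ∀ a f → eval (a · f) x ≈ a * eval f x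
    eval-· a []      = sym (zeroʳ a)
    eval-· a (b ∷ f) = trans
      (+-congˡ (trans (*-congˡ (eval-· a f)) (x*yz≈y*xz x a _)))
      (sym (distribˡ a b _))

    eval-* : ∀ f g → eval (f *ₚ g) x ≈ eval f x * eval g x
    eval-* []      g = sym (zeroˡ _)
    eval-* (a ∷ f) g = trans (eval-+ (a · g) _) (trans
      (+-cong (eval-· a g) (trans (+-identityˡ _) (trans (*-congˡ (eval-* f g)) (sym (*-assoc x _ _)))))
      (sym (distribʳ _ a _)))

  open Exp (CommutativeRing.semiring polyRing) using (_^_)
  open Exp semiring using () renaming (_^_ to _^ᴿ_)

  coeff-Xⁿ-≡ : ∀ n → coeff (X ^ n) n ≈ 1#
  coeff-Xⁿ-≡ zero    = refl
  coeff-Xⁿ-≡ (suc n) = trans (coeff-≈ (X-*ₚ (X ^ n)) (suc n)) (coeff-Xⁿ-≡ n)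

  coeff-Xⁿ-≢ : ∀ n i → i ≡.≢ n → coeff (X ^ n) i ≈ 0#
  coeff-Xⁿ-≢ zero    zero    i≢n = contradiction ≡.refl i≢n
  coeff-Xⁿ-≢ zero    (suc i) i≢n = refl
  coeff-Xⁿ-≢ (suc n) zero    i≢n = coeff-≈ (X-*ₚ (X ^ n)) 0
  coeff-Xⁿ-≢ (suc n) (suc i) i≢n =
    trans (coeff-≈ (X-*ₚ (X ^ n)) (suc i)) (coeff-Xⁿ-≢ n i λ { ≡.refl → i≢n ≡.refl })

  coeff-monomial : ∀ a n i → coeff (monomial a n) i ≈ a * coeff (X ^ n) i
  coeff-monomial a n i =
    trans (coeff-≈ (const-*ₚ a (X ^ n)) i) (coeff-· a (X ^ n) i)

  eval-const : ∀ a x → eval (const a) x ≈ a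
  eval-const a x = trans (+-congˡ (zeroʳ x)) (+-identityʳ a)

  eval-X : ∀ x → eval X x ≈ x
  eval-X x = trans (+-identityˡ _) (trans (*-congˡ (eval-const 1# x)) (*-identityʳ x))

  eval-Xⁿ : ∀ n x → eval (X ^ n) x ≈ x ^ᴿ n
  eval-Xⁿ zero    x = eval-const 1# x
  eval-Xⁿ (suc n) x = trans (eval-* x X (X ^ n)) (*-cong (eval-X x) (eval-Xⁿ n x))

  eval-monomial : ∀ a n x → eval (monomial a n) x ≈ a * x ^ᴿ n
  eval-monomial a n x =
    trans (eval-* x (const a) (X ^ n)) (*-cong (eval-const a x) (eval-Xⁿ n x))

-- Ring homomorphisms applied to coefficients

module PolynomialMap {a ℓ₁ b ℓ₂} (R : CommutativeRing a ℓ₁) (S : CommutativeRing b ℓ₂)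
  (ψ : CommutativeRing.Carrier R → CommutativeRing.Carrier S)
  (ψ-hom : IsRingHomomorphism (CommutativeRing.rawRing R) (CommutativeRing.rawRing S) ψ) where

  private
    module R where
      open CommutativeRing R public
      open Polynomials rawRing public
      open PolynomialRing R public
    module S where
      open CommutativeRing S public
      open Polynomials rawRing public
      open PolynomialRing S public

  open IsRingHomomorphism ψ-hom
  open CommutativeRing S.polyRing using (refl; sym; trans)

  coeff-map : ∀ f i → S.coeff (List.map ψ f) i S.≈ ψ (R.coeff f i)
  coeff-map []      i       = S.sym 0#-homo
  coeff-map (a ∷ f) zero    = S.refl
  coeff-map (a ∷ f) (suc i) = coeff-map f i

  map-cong : ∀ {f g} → f R.≈ₚ g → List.map ψ f S.≈ₚ List.map ψ g
  map-cong {f} {g} e = S.mk≈ₚ λ i →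
    S.trans (coeff-map f i) (S.trans (⟦⟧-cong (R.coeff-≈ e i)) (S.sym (coeff-map g i)))

  map-+ : ∀ f g → List.map ψ (f R.+ₚ g) S.≈ₚ List.map ψ f S.+ₚ List.map ψ g
  map-+ []      g       = refl
  map-+ (a ∷ f) []      = refl
  map-+ (a ∷ f) (b ∷ g) = S.∷-cong (+-homo a b) (map-+ f g)

  map-· : ∀ a f → List.map ψ (a R.· f) S.≈ₚ ψ a S.· List.map ψ f
  map-· a []      = refl
  map-· a (b ∷ f) = S.∷-cong (*-homo a b) (map-· a f)

  map-* : ∀ f g → List.map ψ (f R.*ₚ g) S.≈ₚ List.map ψ f S.*ₚ List.map ψ g
  map-* []      g = refl
  map-* (a ∷ f) g = trans (map-+ (a R.· g) _)
    (S.+ₚ-cong (map-· a g) (S.∷-cong 0#-homo (map-* f g)))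

  map-neg : ∀ f → List.map ψ (List.map R.-_ f) S.≈ₚ List.map S.-_ (List.map ψ f)
  map-neg []      = refl
  map-neg (a ∷ f) = S.∷-cong (-‿homo a) (map-neg f)

  map-1 : List.map ψ (R.const R.1#) S.≈ₚ S.const S.1#
  map-1 = S.∷-cong 1#-homo refl

  private
    module R[x] = Exp (CommutativeRing.semiring R.polyRing)
    module S[x] = Exp (CommutativeRing.semiring S.polyRing)

  map-Xⁿ : ∀ n → List.map ψ (R.X R[x].^ n) S.≈ₚ S.X S[x].^ n
  map-Xⁿ zero    = map-1
  map-Xⁿ (suc n) = trans (map-* R.X (R.X R[x].^ n))
    (S.*ₚ-cong (S.∷-cong 0#-homo map-1) (map-Xⁿ n))

  map-Xⁿ-1 : ∀ n → List.map ψ (R.Xⁿ-1 n) S.≈ₚ S.Xⁿ-1 n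
  map-Xⁿ-1 n = trans (map-+ (R.X R[x].^ n) _)
    (S.+ₚ-cong (map-Xⁿ n) (trans (map-neg (R.const R.1#)) (S.-ₚ-cong map-1)))

-- Multiples and powers under ring homomorphisms

module RingHomomorphismProperties {a ℓ₁ b ℓ₂} (R : CommutativeRing a ℓ₁) (S : CommutativeRing b ℓ₂)
  (ψ : CommutativeRing.Carrier R → CommutativeRing.Carrier S)
  (ψ-hom : IsRingHomomorphism (CommutativeRing.rawRing R) (CommutativeRing.rawRing S) ψ) where

  private
    module R = CommutativeRing R
    module S = CommutativeRing S
  open IsRingHomomorphism ψ-hom
  open Mult R.semiring using () renaming (_×_ to _×ᴿ_)
  open Mult S.semiring using () renaming (_×_ to _×ˢ_)
  open Exp R.semiring using () renaming (_^_ to _^ᴿ_)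
  open Exp S.semiring using () renaming (_^_ to _^ˢ_)

  ×-homo : ∀ n x → ψ (n ×ᴿ x) S.≈ n ×ˢ ψ x
  ×-homo zero    x = 0#-homo
  ×-homo (suc n) x = S.trans (+-homo x _) (S.+-congˡ (×-homo n x))

  ^-homo : ∀ x n → ψ (x ^ᴿ n) S.≈ ψ x ^ˢ n
  ^-homo x zero    = 1#-homo
  ^-homo x (suc n) = S.trans (*-homo x _) (S.*-congˡ (^-homo x n))

  characteristic-homo : ∀ {p} → p ×ᴿ R.1# R.≈ R.0# → p ×ˢ S.1# S.≈ S.0#
  characteristic-homo {p} e = begin
    p ×ˢ S.1#       ≈⟨ Mult.×-congʳ S.semiring p 1#-homo ⟨
    p ×ˢ ψ R.1#     ≈⟨ ×-homo p R.1# ⟨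
    ψ (p ×ᴿ R.1#)   ≈⟨ ⟦⟧-cong e ⟩
    ψ R.0#          ≈⟨ 0#-homo ⟩
    S.0#            ∎
    where open SetoidReasoning S.setoid

-- Degree bounds and division with remainder

module Degree {c ℓ} (R : CommutativeRing c ℓ) where

  open CommutativeRing R hiding (zero)
  open Polynomials rawRing
  open PolynomialRing R
  open RingProperties ring using (-‿distribˡ-*; -0#≈0#)
  private
    module R[x] = CommutativeRing polyRing
  open CommutativeSemigroupProperties R[x].+-commutativeSemigroup using (interchange)

  -- A degree bound that includes the zero polynomial and asks for no leading coefficient, so it
  -- needs no decidable equality. `Below (suc d) f` unfolds to the second half of `HasDegree f d`.
  Below : ℕ → Poly → Set ℓ
  Below n f = ∀ i → n ≤ i → coeff f i ≈ 0#

  below-weaken : ∀ {m n} f → m ≤ n → Below m f → Below n f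
  below-weaken f m≤n b i n≤i = b i (ℕ.≤-trans m≤n n≤i)

  below-cong : ∀ {n f g} → f ≈ₚ g → Below n f → Below n g
  below-cong e b i n≤i = trans (sym (coeff-≈ e i)) (b i n≤i)

  below-length : ∀ f → Below (length f) f
  below-length []      i       _         = refl
  below-length (a ∷ f) (suc i) (s≤s n≤i) = below-length f i n≤i

  below-+ : ∀ {n} f g → Below n f → Below n g → Below n (f +ₚ g)
  below-+ f g p q i n≤i =
    trans (coeff-+ f g i) (trans (+-cong (p i n≤i) (q i n≤i)) (+-identityˡ 0#))

  below-neg : ∀ {n} f → Below n f → Below n (List.map (-_) f)
  below-neg f p i n≤i = trans (coeff-neg f i) (trans (-‿cong (p i n≤i)) -0#≈0#)

  below-· : ∀ {n} a f → Below n f → Below n (a · f)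
  below-· a f p i n≤i = trans (coeff-· a f i) (trans (*-congˡ (p i n≤i)) (zeroʳ a))

  below-∷ : ∀ {n a} f → Below n f → Below (suc n) (a ∷ f)
  below-∷ f p (suc i) (s≤s n≤i) = p i n≤i

  below-zero : ∀ f → Below 0 f → f ≈ₚ []
  below-zero f p = mk≈ₚ λ i → p i z≤n

  below-pred : ∀ {n} f → Below (suc n) f → coeff f n ≈ 0# → Below n f
  below-pred f p f≈0 i n≤i with ℕ.m≤n⇒m<n∨m≡n n≤i
  ... | inj₁ n<i    = p i n<i
  ... | inj₂ ≡.refl = f≈0

  -- Nothing is claimed to be nonzero, so this holds over any commutative ring; it yields both the
  -- additivity of degrees over a field and the monicity of products.
  top-* : ∀ {m n} f g → Below (suc m) f → Below (suc n) g →
          coeff (f *ₚ g) (m ℕ.+ n) ≈ coeff f m * coeff g n × Below (suc (m ℕ.+ n)) (f *ₚ g)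
  top-* {m} {n} [] g p q = sym (zeroˡ _) , λ _ _ → refl
  top-* {zero} {n} (a ∷ f) g p q =
    trans (coeff-≈ e n) (coeff-· a g n) , below-cong (R[x].sym e) (below-· a g q)
    where
    e : (a ∷ f) *ₚ g ≈ₚ a · g
    e = R[x].trans
      (+ₚ-cong R[x].refl (∷-zero refl (*ₚ-cong {f} {[]} {g} (mk≈ₚ λ i → p (suc i) (s≤s z≤n)) R[x].refl)))
      (+ₚ-identityʳ _)
  top-* {suc m} {n} (a ∷ f) g p q =
      trans (coeff-+ (a · g) (0# ∷ f *ₚ g) (suc m ℕ.+ n)) (trans
        (+-cong (below-· a g q _ (s≤s (ℕ.m≤n+m n m))) (proj₁ ih)) (+-identityˡ _))
    , below-+ (a · g) _ (below-· a g (below-weaken g (s≤s (ℕ.m≤n+m n (suc m))) q))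
                        (below-∷ (f *ₚ g) (proj₂ ih))
    where ih = top-* f g (λ i m<i → p (suc i) (s≤s m<i)) q

  take-below : ∀ n f → Below n f → take n f ≈ₚ f
  take-below zero    f       p = R[x].sym (below-zero f p)
  take-below (suc n) []      p = R[x].refl
  take-below (suc n) (a ∷ f) p = ∷-cong refl (take-below n f λ i n≤i → p (suc i) (s≤s n≤i))

  -- The element `u` inverts the top coefficient of `g`, so no field is required. The recursion
  -- strips the constant term: f = q g + r gives a + x f = x q g + (a + x r), and a + x r has degree
  -- at most n, so subtracting one scalar multiple of `g` finishes the step.
  division : ∀ {n} g u → Below (suc n) g → u * coeff g n ≈ 1# →
             ∀ f → ∃₂ λ q r → f ≈ₚ q *ₚ g +ₚ r × Below n r
  division g u g<n ug≈1 []      = [] , [] , R[x].refl , λ _ _ → refl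
  division {n} g u g<n ug≈1 (a ∷ f) with division g u g<n ug≈1 f
  ... | q , r , f≈ , r<n = b ∷ q , h +ₚ (- b) · g , a∷f≈ , r′<n
    where
    h = a ∷ r
    b = coeff h n * u

    cancels : b · g +ₚ (- b) · g ≈ₚ []
    cancels = R[x].trans (R[x].sym (·-distribʳ b (- b) g))
      (R[x].trans (·-cong (-‿inverseʳ b) R[x].refl) (·-zero g))

    a∷f≈ : a ∷ f ≈ₚ (b ∷ q) *ₚ g +ₚ (h +ₚ (- b) · g)
    a∷f≈ = begin
      a ∷ f                                            ≈⟨ ∷-cong (sym (+-identityˡ a)) f≈ ⟩
      (0# ∷ q *ₚ g) +ₚ h                               ≈⟨ +ₚ-cong cancels R[x].refl ⟨
      (b · g +ₚ (- b) · g) +ₚ ((0# ∷ q *ₚ g) +ₚ h)     ≈⟨ interchange (b · g) _ _ h ⟩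
      (b · g +ₚ (0# ∷ q *ₚ g)) +ₚ ((- b) · g +ₚ h)     ≈⟨ +ₚ-cong (R[x].refl {b · g +ₚ (0# ∷ q *ₚ g)}) (+ₚ-comm ((- b) · g) h) ⟩
      (b · g +ₚ (0# ∷ q *ₚ g)) +ₚ (h +ₚ (- b) · g)     ∎
      where open SetoidReasoning R[x].setoid

    bgₙ≈hₙ : b * coeff g n ≈ coeff h n
    bgₙ≈hₙ = trans (*-assoc _ u _) (trans (*-congˡ ug≈1) (*-identityʳ _))

    r′<n : Below n (h +ₚ (- b) · g)
    r′<n = below-pred (h +ₚ (- b) · g)
      (below-+ h ((- b) · g) (below-∷ r r<n) (below-· (- b) g g<n))
      (trans (coeff-+ h ((- b) · g) n) (trans
        (+-congˡ (trans (coeff-· (- b) g n) (trans (sym (-‿distribˡ-* b _)) (-‿cong bgₙ≈hₙ))))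
        (-‿inverseʳ _)))

-- Polynomials over a field: degrees, Bezout relations, roots

record IsDecidableField {c ℓ} (R : CommutativeRing c ℓ) : Set (c ⊔ ℓ) where
  open CommutativeRing R hiding (zero)
  field
    _≟_     : Decidable _≈_
    1≉0     : 1# ≉ 0#
    inverse : ∀ x → x ≉ 0# → ∃[ y ] y * x ≈ 1#

module FieldPolynomials {c ℓ} (F : CommutativeRing c ℓ) (isField : IsDecidableField F) where

  open CommutativeRing F hiding (zero)
  open IsDecidableField isField
  open Polynomials rawRing
  open PolynomialRing F
  open Degree F
  open GroupProperties +-group using (x∙y⁻¹≈ε⇒x≈y; x≈y⇒x∙y⁻¹≈ε)
  open RingProperties ring using ([y-z]x≈yx-zx)
  private
    module F[x] where
      open CommutativeRing polyRing public
      open SemiringDivisibility (CommutativeRing.semiring polyRing) public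

  *-cancelʳ-0 : ∀ {x y} → x ≉ 0# → y * x ≈ 0# → y ≈ 0#
  *-cancelʳ-0 {x} {y} x≉0 yx≈0 with inverse x x≉0
  ... | x⁻¹ , x⁻¹x≈1 = begin
    y               ≈⟨ *-identityʳ y ⟨
    y * 1#          ≈⟨ *-congˡ (trans (*-comm x x⁻¹) x⁻¹x≈1) ⟨
    y * (x * x⁻¹)   ≈⟨ *-assoc y x x⁻¹ ⟨
    y * x * x⁻¹     ≈⟨ *-congʳ yx≈0 ⟩
    0# * x⁻¹        ≈⟨ zeroˡ x⁻¹ ⟩
    0#              ∎
    where open SetoidReasoning setoid

  *-cancelʳ : ∀ {x y z} → x ≉ 0# → y * x ≈ z * x → y ≈ z
  *-cancelʳ {x} {y} {z} x≉0 yx≈zx = x∙y⁻¹≈ε⇒x≈y y z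
    (*-cancelʳ-0 x≉0 (trans ([y-z]x≈yx-zx x y z) (x≈y⇒x∙y⁻¹≈ε yx≈zx)))

  degree : ∀ f → f ≈ₚ [] ⊎ ∃[ d ] HasDegree f d
  degree []      = inj₁ F[x].refl
  degree (a ∷ f) with degree f | a ≟ 0#
  ... | inj₂ (d , fd≉0 , f<) | _       = inj₂ (suc d , fd≉0 , λ { (suc i) (s≤s d<i) → f< i d<i })
  ... | inj₁ f≈0             | yes a≈0 = inj₁ (∷-zero a≈0 f≈0)
  ... | inj₁ f≈0             | no a≉0  = inj₂ (0 , a≉0 , λ { (suc i) _ → coeff-≈ f≈0 i })

  hasDegree-* : ∀ {m n} f g → HasDegree f m → HasDegree g n → HasDegree (f *ₚ g) (m ℕ.+ n)
  hasDegree-* f g (fm≉0 , f<) (gn≉0 , g<) with top-* f g f< g<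
  ... | top , fg< = (λ fg≈0 → fm≉0 (*-cancelʳ-0 gn≉0 (trans (sym top) fg≈0))) , fg<

  hasDegree-cong : ∀ {n f g} → f ≈ₚ g → HasDegree f n → HasDegree g n
  hasDegree-cong e (fn≉0 , f<) = (λ gn≈0 → fn≉0 (trans (coeff-≈ e _) gn≈0)) , below-cong e f<

  hasDegree-unique : ∀ {m n} f → HasDegree f m → HasDegree f n → m ≡ n
  hasDegree-unique f (fm≉0 , f<m) (fn≉0 , f<n) = ℕ.≤-antisym
    (ℕ.≮⇒≥ λ n<m → fm≉0 (f<n _ n<m)) (ℕ.≮⇒≥ λ m<n → fn≉0 (f<m _ m<n))

  -- If `w` had a degree e, the product would have degree e + d. This is the source of cancellation
  -- and of every later argument that a multiple of too small a degree vanishes.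
  multiple-below : ∀ {m d} w → HasDegree m d → Below d (w *ₚ m) → w ≈ₚ []
  multiple-below {m} {d} w degm wm<d with degree w
  ... | inj₁ w≈0        = w≈0
  ... | inj₂ (e , degw) =
    contradiction (wm<d _ (ℕ.m≤n+m d e)) (proj₁ (hasDegree-* w m degw degm))

  HasDegreeMonic : Poly → ℕ → Set ℓ
  HasDegreeMonic f d = HasDegree f d × coeff f d ≈ 1#

  hasDegreeMonic : ∀ {d} f → Below (suc d) f → coeff f d ≈ 1# → HasDegreeMonic f d
  hasDegreeMonic f f< fd≈1 = ((λ fd≈0 → 1≉0 (trans (sym fd≈1) fd≈0)) , f<) , fd≈1

  hasDegreeMonic-1 : HasDegreeMonic (const 1#) 0
  hasDegreeMonic-1 = hasDegreeMonic (const 1#) (below-length (const 1#)) refl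

  hasDegreeMonic-* : ∀ {m n} f g → HasDegreeMonic f m → HasDegreeMonic g n →
                     HasDegreeMonic (f *ₚ g) (m ℕ.+ n)
  hasDegreeMonic-* f g ((_ , f<) , fm≈1) ((_ , g<) , gn≈1) with top-* f g f< g<
  ... | top , fg< = hasDegreeMonic (f *ₚ g) fg< (trans top (trans (*-cong fm≈1 gn≈1) (*-identityˡ 1#)))

  -- Stated at `suc n` because `Xⁿ-1 0` is the zero polynomial.
  hasDegreeMonic-Xⁿ-1 : ∀ n → HasDegreeMonic (Xⁿ-1 (suc n)) (suc n)
  hasDegreeMonic-Xⁿ-1 n = hasDegreeMonic (Xⁿ-1 (suc n))
    (below-+ (X ^ suc n) (F[x].- const 1#) (λ i n<i → coeff-Xⁿ-≢ (suc n) i (ℕ.>⇒≢ n<i))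
      (below-weaken (F[x].- const 1#) (s≤s z≤n) (below-length (F[x].- const 1#))))
    (trans (coeff-+ (X ^ suc n) (F[x].- const 1#) (suc n)) (trans (+-identityʳ _) (coeff-Xⁿ-≡ (suc n))))
    where open Exp (CommutativeRing.semiring polyRing) using (_^_)

  *ₚ-cancelʳ : ∀ {m d} f g → HasDegree m d → f *ₚ m ≈ₚ g *ₚ m → f ≈ₚ g
  *ₚ-cancelʳ {m} f g degm fm≈gm = GroupProperties.x∙y⁻¹≈ε⇒x≈y F[x].+-group f g
    (multiple-below (f F[x].- g) degm (below-cong (F[x].sym fm-gm≈0) λ _ _ → refl))
    where
    fm-gm≈0 : (f F[x].- g) *ₚ m ≈ₚ []
    fm-gm≈0 = F[x].trans (RingProperties.[y-z]x≈yx-zx F[x].ring m f g)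
      (GroupProperties.x≈y⇒x∙y⁻¹≈ε F[x].+-group fm≈gm)

  -- Euclid's algorithm, with recursion on a degree bound for `g` instead of its degree: a vanishing
  -- top coefficient lowers the bound, otherwise (f, g) is replaced by (g, r). The common divisor is
  -- not normalised to be monic.
  bezout : ∀ n f g → Below n g →
           ∃[ d ] (∃₂ λ u v → d ≈ₚ u *ₚ f +ₚ v *ₚ g) × d F[x].∣ f × d F[x].∣ g
  bezout zero f g g<0 =
      f , (const 1# , [] , F[x].sym (F[x].trans (+ₚ-identityʳ _) (*ₚ-identityˡ f)))
    , F[x].∣-refl , F[x].∣-respʳ-≈ (F[x].sym (below-zero g g<0)) (f F[x].∣0)
  bezout (suc n) f g g<1+n with coeff g n ≟ 0#
  ... | yes gₙ≈0 = bezout n f g (below-pred g g<1+n gₙ≈0)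
  ... | no gₙ≉0 with inverse _ gₙ≉0
  ... | u , ugₙ≈1 with division g u g<1+n ugₙ≈1 f
  ... | q , r , f≈ , r<n with bezout n g r r<n
  ... | d , (u′ , v , d≈) , d∣g@(gq ,∣ gqd≈g) , (rq ,∣ rqd≈r) =
    d , (v , u′ +ₚ w , d≈′) , (q *ₚ gq +ₚ rq ,∣ d∣f) , d∣g
    where
    open SetoidReasoning F[x].setoid
    open SemiringSolver F[x].commutativeSemiring

    -- Substituting r = f - q g into u′ g + v r gives v f + (u′ - v q) g. The negative is kept as an
    -- atom `w` with v q + w = 0, so that the remaining identity is one of commutative semirings.
    w = F[x].- (v *ₚ q)

    d≈′ : d ≈ₚ v *ₚ f +ₚ (u′ +ₚ w) *ₚ g
    d≈′ = begin
      d                                             ≈⟨ d≈ ⟩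
      u′ *ₚ g +ₚ v *ₚ r                              ≈⟨ +ₚ-identityʳ _ ⟨
      (u′ *ₚ g +ₚ v *ₚ r) +ₚ [] *ₚ g                 ≈⟨ F[x].+-congˡ {u′ *ₚ g +ₚ v *ₚ r} (*ₚ-cong (F[x].-‿inverseʳ (v *ₚ q)) (F[x].refl {g})) ⟨
      (u′ *ₚ g +ₚ v *ₚ r) +ₚ (v *ₚ q +ₚ w) *ₚ g      ≈⟨ solve 6 (λ u′ v g r q w →
        (u′ :* g :+ v :* r) :+ (v :* q :+ w) :* g := v :* (q :* g :+ r) :+ (u′ :+ w) :* g) F[x].refl u′ v g r q w ⟩
      v *ₚ (q *ₚ g +ₚ r) +ₚ (u′ +ₚ w) *ₚ g           ≈⟨ F[x].+-congʳ {(u′ +ₚ w) *ₚ g} (*ₚ-congˡ v f≈) ⟨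
      v *ₚ f +ₚ (u′ +ₚ w) *ₚ g                       ∎

    d∣f : (q *ₚ gq +ₚ rq) *ₚ d ≈ₚ f
    d∣f = begin
      (q *ₚ gq +ₚ rq) *ₚ d          ≈⟨ *ₚ-distribʳ d (q *ₚ gq) rq ⟩
      q *ₚ gq *ₚ d +ₚ rq *ₚ d       ≈⟨ +ₚ-cong (F[x].trans (*ₚ-assoc q gq d) (*ₚ-congˡ q gqd≈g)) rqd≈r ⟩
      q *ₚ g +ₚ r                   ≈⟨ f≈ ⟨
      f                             ∎

  -- Horner's scheme: `deflate x f` is the quotient of `a ∷ f` by X - x, for every constant term
  -- `a`.
  deflate : Carrier → Poly → Poly
  deflate x []      = []
  deflate x (a ∷ f) = eval (a ∷ f) x ∷ deflate x f

  length-deflate : ∀ x f → length (deflate x f) ≡ length f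
  length-deflate x []      = ≡.refl
  length-deflate x (a ∷ f) = ≡.cong suc (length-deflate x f)

  deflate≈0 : ∀ x f → deflate x f ≈ₚ [] → f ≈ₚ []
  deflate≈0 x []      e = F[x].refl
  deflate≈0 x (a ∷ f) e = ∷-zero
    (trans (sym (trans (+-congˡ (trans (*-congˡ (eval-zero {f} x f≈0)) (zeroʳ x))) (+-identityʳ a)))
           (coeff-≈ e 0))
    f≈0
    where f≈0 = deflate≈0 x f (mk≈ₚ λ i → coeff-≈ e (suc i))

  -- f(y) - f(x) = (y - x) q(y) for f = a ∷ g and q = deflate x g, with the
  -- negative terms moved across.
  eval-deflate : ∀ a f x y → eval (a ∷ f) y + x * eval (deflate x f) y ≈
                             eval (a ∷ f) x + y * eval (deflate x f) y
  eval-deflate a [] x y =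
    solve 3 (λ a x y → (a :+ y :* con 0) :+ x :* con 0 := (a :+ x :* con 0) :+ y :* con 0) refl a x y
    where open SemiringSolver commutativeSemiring
  eval-deflate a f@(b ∷ f′) x y = begin
    (a + y * fy) + x * (fx + y * q)  ≈⟨ solve 6 (λ a x y fx fy q → (a :+ y :* fy) :+ x :* (fx :+ y :* q)
                                          := (a :+ x :* fx) :+ y :* (fy :+ x :* q)) refl a x y fx fy q ⟩
    (a + x * fx) + y * (fy + x * q)  ≈⟨ +-congˡ (*-congˡ (eval-deflate b f′ x y)) ⟩
    (a + x * fx) + y * (fx + y * q)  ∎
    where
    open SetoidReasoning setoid
    open SemiringSolver commutativeSemiring
    fx = eval f x
    fy = eval f y
    q  = eval (deflate x f′) y

  -- Dividing by X - x₀ uses up one root. The other points stay roots of the quotient, since they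
  -- differ from x₀ and a field has no zero divisors. The bound is on list length, which drops by
  -- one at each deflation.
  root-bound-length : ∀ {n} f → length f ≤ n → (x : Fin n → Carrier) →
               (∀ i j → x i ≈ x j → i ≡ j) → (∀ i → eval f (x i) ≈ 0#) → f ≈ₚ []
  root-bound-length []      _       x inj root = F[x].refl
  root-bound-length {suc n} (a ∷ f) (s≤s f≤n) x inj root = ∷-zero a≈0 f≈0
    where
    q = deflate (x zero) f

    root-q : ∀ i → eval q (x (suc i)) ≈ 0#
    root-q i = *-cancelʳ-0 y-x≉0 (trans (*-comm _ _) (trans ([y-z]x≈yx-zx _ y z)
      (x≈y⇒x∙y⁻¹≈ε (begin
        y * e                     ≈⟨ +-identityˡ _ ⟨
        0# + y * e                ≈⟨ +-congʳ (root zero) ⟨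
        eval (a ∷ f) z + y * e    ≈⟨ eval-deflate a f z y ⟨
        eval (a ∷ f) y + z * e    ≈⟨ +-congʳ (root (suc i)) ⟩
        0# + z * e                ≈⟨ +-identityˡ _ ⟩
        z * e                     ∎))))
      where
      open SetoidReasoning setoid
      y = x (suc i)
      z = x zero
      e = eval q y
      y-x≉0 : y - z ≉ 0#
      y-x≉0 p with () ← inj (suc i) zero (x∙y⁻¹≈ε⇒x≈y _ _ p)

    f≈0 : f ≈ₚ []
    f≈0 = deflate≈0 (x zero) f (root-bound-length q
      (ℕ.≤-trans (ℕ.≤-reflexive (length-deflate _ f)) f≤n) (x ∘ suc)
      (λ i j e → suc-inj (inj (suc i) (suc j) e)) root-q)
      where
      suc-inj : ∀ {i j : Fin n} → suc i ≡ suc j → i ≡ j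
      suc-inj ≡.refl = ≡.refl

    a≈0 : a ≈ 0#
    a≈0 = trans (sym (trans (+-congˡ (trans (*-congˡ (eval-zero {f} (x zero) f≈0)) (zeroʳ _))) (+-identityʳ a)))
      (root zero)

  -- Truncating the list turns the degree bound into the length bound required above.
  root-bound : ∀ {n} f → Below n f → (x : Fin n → Carrier) →
               (∀ i j → x i ≈ x j → i ≡ j) → (∀ i → eval f (x i) ≈ 0#) → f ≈ₚ []
  root-bound {n} f f<n x inj root = F[x].trans (F[x].sym take≈f)
    (root-bound-length (take n f)
      (ℕ.≤-trans (ℕ.≤-reflexive (List.length-take n f)) (ℕ.m⊓n≤m n _)) x inj
      (λ i → trans (eval-cong {take n f} take≈f refl) (root i)))
    where take≈f = take-below n f f<n

-- Binomial coefficients modulo p and the Frobenius endomorphism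

prime∣n!⇒p≤n : ∀ {p} n → Prime p → p ℕ∣.∣ n ! → p ≤ n
prime∣n!⇒p≤n {p} zero    pp p∣1 = contradiction (ℕ∣.∣1⇒≡1 p∣1)
  (ℕ.nonTrivial⇒≢1 {{prime⇒nonTrivial pp}})
prime∣n!⇒p≤n (suc n) pp p∣n! with euclidsLemma (suc n) (n !) pp p∣n!
... | inj₁ p∣1+n = ℕ∣.∣⇒≤ p∣1+n
... | inj₂ p∣n!  = ℕ.m≤n⇒m≤1+n (prime∣n!⇒p≤n n pp p∣n!)

-- p divides p! = (p C k) · k! · (p - k)!, but neither factorial, because a prime dividing j! is at
-- most j and both k and p - k are below p.
prime∣nCk : ∀ {p k} → Prime p → 0 < k → k < p → p ℕ∣.∣ p C k
prime∣nCk {p} {k} pp 0<k k<p with euclidsLemma (p C k) (k ! ℕ.* (p ∸ k) !) pp p∣C*k![p-k]!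
  where
  instance
    k!*[p-k]!≢0 = k ℕ.!* (p ∸ k) !≢0

  C*k![p-k]!≡p! : (p C k) ℕ.* (k ! ℕ.* (p ∸ k) !) ≡ p !
  C*k![p-k]!≡p! = ≡.trans
    (≡.cong (ℕ._* (k ! ℕ.* (p ∸ k) !)) (nCk≡n!/k![n-k]! (ℕ.<⇒≤ k<p)))
    (m/n*n≡m (k![n∸k]!∣n! (ℕ.<⇒≤ k<p)))

  n∣n! : ∀ n → .{{ℕ.NonZero n}} → n ℕ∣.∣ n !
  n∣n! (suc n) = ℕ∣.m∣m*n (n !)

  p∣C*k![p-k]! = ≡.subst (p ℕ∣.∣_) (≡.sym C*k![p-k]!≡p!) (n∣n! p {{prime⇒nonZero pp}})
... | inj₁ p∣C = p∣C
... | inj₂ p∣k![p-k]! with euclidsLemma (k !) ((p ∸ k) !) pp p∣k![p-k]!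
... | inj₁ p∣k!     = contradiction (prime∣n!⇒p≤n k pp p∣k!) (ℕ.<⇒≱ k<p)
... | inj₂ p∣[p-k]! = contradiction (prime∣n!⇒p≤n (p ∸ k) pp p∣[p-k]!)
  (ℕ.<⇒≱ (ℕ.∸-monoʳ-< 0<k (ℕ.<⇒≤ k<p)))

module Frobenius {c ℓ} (R : CommutativeRing c ℓ) where

  open CommutativeRing R hiding (zero)
  open CommutativeExp commutativeSemiring
  open Mult semiring using (×-assoc-*; ×-congʳ; ×-assocˡ; ×-homo-1) renaming (_×_ to _×ᴿ_)
  open Sum semiring using (sum; sum-init-last; sum-cong-≋; sum-replicate-zero)
  open Binomial commutativeSemiring using (theorem; binomialTerm)
  open RingProperties ring using (x+x≈x⇒x≈0)
  open GroupProperties +-group using (inverseˡ-unique)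

  ^-one : ∀ n → 1# ^ n ≈ 1#
  ^-one zero    = refl
  ^-one (suc n) = trans (*-identityˡ _) (^-one n)

  p∣n⇒n×x≈0 : ∀ {n p} → p ×ᴿ 1# ≈ 0# → p ℕ∣.∣ n → ∀ x → n ×ᴿ x ≈ 0#
  p∣n⇒n×x≈0 {p = p} p×1≈0 (ℕ∣.divides k ≡.refl) x = begin
    (k ℕ.* p) ×ᴿ x       ≈⟨ ×-assocˡ x k p ⟨
    k ×ᴿ p ×ᴿ x          ≈⟨ ×-congʳ k (×-congʳ p (*-identityˡ x)) ⟨
    k ×ᴿ p ×ᴿ (1# * x)   ≈⟨ ×-congʳ k (trans (sym (×-assoc-* p 1# x)) (trans (*-congʳ p×1≈0) (zeroˡ x))) ⟩
    k ×ᴿ 0#              ≈⟨ k×0≈0 k ⟩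
    0#                   ∎
    where
    open SetoidReasoning setoid
    k×0≈0 : ∀ k → k ×ᴿ 0# ≈ 0#
    k×0≈0 zero    = refl
    k×0≈0 (suc k) = trans (+-identityˡ _) (k×0≈0 k)

  -- Of the binomial expansion only the two end terms survive, since p divides every coefficient in
  -- between.
  ^p-+ : ∀ {p} → Prime p → p ×ᴿ 1# ≈ 0# → ∀ x y → (x + y) ^ p ≈ x ^ p + y ^ p
  ^p-+ {zero}       p-prime _     x y = contradiction p-prime ¬prime[0]
  ^p-+ {p@(suc p′)} p-prime p×1≈0 x y = begin
    (x + y) ^ p                                  ≈⟨ theorem p x y ⟩
    t zero + sum (t ∘ suc)                       ≈⟨ +-cong t₀≈ (sum-init-last (t ∘ suc)) ⟩
    y ^ p + (sum (t ∘ suc ∘ inject₁) + t (suc (fromℕ p′)))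
                                                 ≈⟨ +-congˡ (+-cong middle≈0 tₚ≈) ⟩
    y ^ p + (0# + x ^ p)                         ≈⟨ trans (+-congˡ (+-identityˡ _)) (+-comm _ _) ⟩
    x ^ p + y ^ p                                ∎
    where
    open SetoidReasoning setoid
    t = binomialTerm x y p

    t₀≈ : t zero ≈ y ^ p
    t₀≈ = trans (×-homo-1 _) (*-identityˡ _)

    middle≈0 : sum (t ∘ suc ∘ inject₁) ≈ 0#
    middle≈0 = trans (sum-cong-≋ λ i → p∣n⇒n×x≈0 p×1≈0 (prime∣nCk p-prime (s≤s z≤n) (s≤s
        (≡.subst (_< p′) (≡.sym (Fin.toℕ-inject₁ i)) (Fin.toℕ<n i)))) _)
      (sum-replicate-zero p′)

    tₚ≈ : t (suc (fromℕ p′)) ≈ x ^ p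
    tₚ≈ rewrite Fin.toℕ-fromℕ p′ | nCn≡1 p | ℕ.n∸n≡0 p′ =
      trans (×-homo-1 _) (*-identityʳ _)

  module _ {p} (p-prime : Prime p) (p×1≈0 : p ×ᴿ 1# ≈ 0#) where

    ^pᵐ-+ : ∀ m x y → (x + y) ^ (p ℕ.^ m) ≈ x ^ (p ℕ.^ m) + y ^ (p ℕ.^ m)
    ^pᵐ-+ zero    x y = trans (*-identityʳ _) (sym (+-cong (*-identityʳ x) (*-identityʳ y)))
    ^pᵐ-+ (suc m) x y = begin
      (x + y) ^ (p ℕ.* r)             ≈⟨ ^-assocʳ (x + y) p r ⟨
      ((x + y) ^ p) ^ r               ≈⟨ ^-congˡ r (^p-+ p-prime p×1≈0 x y) ⟩
      (x ^ p + y ^ p) ^ r             ≈⟨ ^pᵐ-+ m (x ^ p) (y ^ p) ⟩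
      (x ^ p) ^ r + (y ^ p) ^ r       ≈⟨ +-cong (^-assocʳ x p r) (^-assocʳ y p r) ⟩
      x ^ (p ℕ.* r) + y ^ (p ℕ.* r)   ∎
      where
      open SetoidReasoning setoid
      r = p ℕ.^ m

    frobenius-isRingHomomorphism : ∀ {m q} → q ≡ p ℕ.^ m →
                                   IsRingHomomorphism rawRing rawRing (_^ q)
    frobenius-isRingHomomorphism {m} {q} ≡.refl = record
      { isSemiringHomomorphism = record
        { isNearSemiringHomomorphism = record
          { +-isMonoidHomomorphism = record
            { isMagmaHomomorphism = record
              { isRelHomomorphism = record { cong = ^-congˡ q }
              ; homo              = ^pᵐ-+ m
              }
            ; ε-homo = 0^q≈0
            }
          ; *-homo = λ x y → ^-distrib-* x y q
          }
        ; 1#-homo = ^-one q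
        }
      ; -‿homo = λ x → inverseˡ-unique _ _ (trans (sym (^pᵐ-+ m (- x) x))
                         (trans (^-congˡ q (-‿inverseˡ x)) 0^q≈0))
      }
      where
      0^q≈0 : 0# ^ q ≈ 0#
      -- Additivity at 0 + 0 gives z + z = z for z = 0 ^ q, which avoids asking whether q is
      -- positive.
      0^q≈0 = x+x≈x⇒x≈0 _ (trans (sym (^pᵐ-+ m 0# 0#)) (^-congˡ q (+-identityˡ 0#)))

-- Evaluation with x acting as an endomorphism σ

module TwistedEvaluation {c ℓ} (R : CommutativeRing c ℓ)
  (σ : CommutativeRing.Carrier R → CommutativeRing.Carrier R)
  (σ-hom : IsRingHomomorphism (CommutativeRing.rawRing R) (CommutativeRing.rawRing R) σ) where

  open CommutativeRing R hiding (zero)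
  open Polynomials rawRing
  open PolynomialRing R
  open IsRingHomomorphism σ-hom
  open CommutativeSemigroupProperties +-commutativeSemigroup using (interchange)
  open GroupProperties +-group using (inverseˡ-unique)
  private
    module R[x] = CommutativeRing polyRing
  open Exp R[x].semiring using (_^_)

  -- Σ fᵢ σⁱ(β), the skew polynomial Σ fᵢ σⁱ applied to β; the argument is shifted so that no index
  -- is carried.
  T : Poly → Carrier → Carrier
  T []      β = 0#
  T (a ∷ f) β = a * β + T f (σ β)

  T-zero : ∀ {f} β → f ≈ₚ [] → T f β ≈ 0#
  T-zero {[]}    β e = refl
  T-zero {a ∷ f} β e = trans
    (+-cong (trans (*-congʳ (coeff-≈ e 0)) (zeroˡ β)) (T-zero {f} (σ β) (mk≈ₚ λ i → coeff-≈ e (suc i))))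
    (+-identityˡ 0#)

  T-cong : ∀ {f g β γ} → f ≈ₚ g → β ≈ γ → T f β ≈ T g γ
  T-cong {[]}    {g}     {β} {γ} e p = sym (T-zero γ (R[x].sym e))
  T-cong {a ∷ f} {[]}    {β} {γ} e p = T-zero β e
  T-cong {a ∷ f} {b ∷ g}         e p =
    +-cong (*-cong (coeff-≈ e 0) p) (T-cong {f} {g} (mk≈ₚ λ i → coeff-≈ e (suc i)) (⟦⟧-cong p))

  T-zeroʳ : ∀ f {β} → β ≈ 0# → T f β ≈ 0#
  T-zeroʳ []      β≈0 = refl
  T-zeroʳ (a ∷ f) β≈0 = trans
    (+-cong (trans (*-congˡ β≈0) (zeroʳ a)) (T-zeroʳ f (trans (⟦⟧-cong β≈0) 0#-homo)))
    (+-identityˡ 0#)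

  T-+ : ∀ f g β → T (f +ₚ g) β ≈ T f β + T g β
  T-+ []      g       β = sym (+-identityˡ _)
  T-+ (a ∷ f) []      β = sym (+-identityʳ _)
  T-+ (a ∷ f) (b ∷ g) β = trans (+-cong (distribʳ β a b) (T-+ f g (σ β))) (interchange _ _ _ _)

  T-· : ∀ a f β → T (a · f) β ≈ a * T f β
  T-· a []      β = sym (zeroʳ a)
  T-· a (b ∷ f) β = trans (+-cong (*-assoc a b β) (T-· a f (σ β))) (sym (distribˡ a _ _))

  T-neg : ∀ f β → T (R[x].- f) β ≈ - T f β
  T-neg f β = inverseˡ-unique _ _ (trans (sym (T-+ (R[x].- f) f β)) (T-zero β (R[x].-‿inverseˡ f)))

  T-0∷ : ∀ f β → T (0# ∷ f) β ≈ T f (σ β)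
  T-0∷ f β = trans (+-congʳ (zeroˡ β)) (+-identityˡ _)

  T-1 : ∀ β → T (const 1#) β ≈ β
  T-1 β = trans (+-identityʳ _) (*-identityˡ β)

  Fixed : Poly → Set ℓ
  Fixed f = ∀ i → σ (coeff f i) ≈ coeff f i

  σ-T : ∀ f β → σ (T f β) ≈ T (List.map σ f) (σ β)
  σ-T []      β = 0#-homo
  σ-T (a ∷ f) β = trans (+-homo _ _) (+-cong (*-homo a β) (σ-T f (σ β)))

  open PolynomialMap R R σ σ-hom using (coeff-map)

  map-fixed : ∀ f → Fixed f → List.map σ f ≈ₚ f
  map-fixed f fix = mk≈ₚ λ i → trans (coeff-map f i) (fix i)

  -- Moving σ past the value of `g` also applies it to the coefficients of `g`, by `σ-T`; only when
  -- these are fixed does composition match the commutative product.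
  T-* : ∀ f g → Fixed g → ∀ β → T (f *ₚ g) β ≈ T f (T g β)
  T-* []      g fix β = refl
  T-* (a ∷ f) g fix β = begin
    T (a · g +ₚ (0# ∷ f *ₚ g)) β          ≈⟨ T-+ (a · g) _ β ⟩
    T (a · g) β + T (0# ∷ f *ₚ g) β       ≈⟨ +-cong (T-· a g β) (trans (T-0∷ (f *ₚ g) β) (T-* f g fix (σ β))) ⟩
    a * T g β + T f (T g (σ β))           ≈⟨ +-congˡ (T-cong {f} R[x].refl
                                               (trans (σ-T g β) (T-cong (map-fixed g fix) refl))) ⟨
    a * T g β + T f (σ (T g β))           ∎
    where open SetoidReasoning setoid

  -- σ is applied innermost, matching the recursion of `T`.
  σ^ : ℕ → Carrier → Carrier
  σ^ zero    β = β
  σ^ (suc i) β = σ^ i (σ β)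

  σ-σ^ : ∀ i β → σ (σ^ i β) ≡ σ^ i (σ β)
  σ-σ^ zero    β = ≡.refl
  σ-σ^ (suc i) β = σ-σ^ i (σ β)

  T-Xⁿ : ∀ n β → T (X ^ n) β ≈ σ^ n β
  T-Xⁿ zero    β = T-1 β
  T-Xⁿ (suc n) β = trans (T-cong (X-*ₚ (X ^ n)) refl) (trans (T-0∷ (X ^ n) β) (T-Xⁿ n (σ β)))

  T-Xⁿ-1 : ∀ n β → T (Xⁿ-1 n) β ≈ σ^ n β - β
  T-Xⁿ-1 n β = trans (T-+ (X ^ n) _ β) (+-cong (T-Xⁿ n β) (trans (T-neg (const 1#) β) (-‿cong (T-1 β))))

-- Finite fields: inverses, characteristic, and aᵠ = a

module FiniteFieldProperties {c ℓ₁ ℓ₂ q} (F : FiniteField c ℓ₁ ℓ₂ q) where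

  open FiniteField F hiding (zero; setoid)
  open CommutativeRing commutativeRing using
    (ring; semiring; setoid; +-group; +-commutativeMonoid; *-commutativeMonoid)
  open Bijection enumeration using () renaming (to to index; cong to index-cong)
  open Exp semiring using (_^_)
  open Mult semiring using (×1-homo-*; ×-homo-1) renaming (_×_ to _×ᴿ_)

  element : Fin q → Carrier
  element i = proj₁ (Bijection.surjective enumeration i)

  index-element : ∀ i → index (element i) ≡ i
  index-element i = proj₂ (Bijection.surjective enumeration i) refl

  element-index : ∀ x → element (index x) ≈ x
  element-index x = Bijection.injective enumeration (index-element (index x))

  element-injective : ∀ {i j} → element i ≈ element j → i ≡ j
  element-injective {i} {j} e =
    ≡.trans (≡.sym (index-element i)) (≡.trans (index-cong e) (index-element j))

  -- If 1 = 0, then 0 - 0 is invertible, so 0 is apart from itself.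
  1≉0 : 1# ≉ 0#
  1≉0 1≈0 = #-irrefl refl (invertible⇒# {0#} {0#} (0# , invˡ , trans (*-comm _ _) invˡ))
    where
    invˡ : 0# * (0# - 0#) ≈ 1#
    invˡ = trans (zeroˡ _) (sym 1≈0)

  -- Tightness alone only yields ¬ ¬ x # 0#, so the inverse is found by search.
  inverse : ∀ x → x ≉ 0# → ∃[ y ] y * x ≈ 1#
  inverse x x≉0 with Fin.any? (λ i → (element i * x) ≟ 1#)
  ... | yes (i , e) = element i , e
  ... | no  ∄x⁻¹    = contradiction (proj₁ (tight x 0#) ¬x#0) x≉0
    where
    x-0≈x : x - 0# ≈ x
    x-0≈x = trans (+-congˡ (RingProperties.-0#≈0# ring)) (+-identityʳ x)

    ¬x#0 : ¬ x # 0#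
    ¬x#0 x#0 with #⇒invertible x#0
    ... | y , yx≈1 , _ = ∄x⁻¹
      (index y , trans (*-cong (element-index y) (sym x-0≈x)) yx≈1)

  isDecidableField : IsDecidableField commutativeRing
  isDecidableField = record { _≟_ = _≟_ ; 1≉0 = 1≉0 ; inverse = inverse }

  open FieldPolynomials commutativeRing isDecidableField using (*-cancelʳ-0; *-cancelʳ)

  1<q : 1 < q
  1<q = two (index 0#) (index 1#) λ e → 1≉0 (sym (Bijection.injective enumeration e))
    where
    two : ∀ {n} (i j : Fin n) → i ≢ j → 1 < n
    two {suc zero}    zero zero i≢j = contradiction ≡.refl i≢j
    two {suc (suc n)} i    j    _   = s≤s (s≤s z≤n)

  permute : (f g : Carrier → Carrier) → (∀ {x y} → x ≈ y → f x ≈ f y) → (∀ {x y} → x ≈ y → g x ≈ g y) →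
            (∀ x → f (g x) ≈ x) → (∀ x → g (f x) ≈ x) → Permutation′ q
  permute f g f-cong g-cong fg gf = permutation (index ∘ f ∘ element) (index ∘ g ∘ element)
    (λ i → ≡.trans (index-cong (trans (f-cong (element-index _)) (fg _))) (index-element i))
    (λ i → ≡.trans (index-cong (trans (g-cong (element-index _)) (gf _))) (index-element i))

  -- Adding 1 permutes the elements, so their sum S satisfies S = S + q · 1.
  q×1≈0 : q ×ᴿ 1# ≈ 0#
  q×1≈0 = identityʳ-unique (sum element) _ (begin
    sum element + q ×ᴿ 1#             ≈⟨ +-congˡ (sum-replicate q) ⟨
    sum element + sum {q} (λ _ → 1#)  ≈⟨ ∑-distrib-+ element _ ⟨
    sum (λ i → element i + 1#)        ≈⟨ sum-cong-≋ (λ i → element-index (element i + 1#)) ⟨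
    sum (λ i → element (π ⟨$⟩ʳ i))    ≈⟨ sum-permute element π ⟨
    sum element                       ∎)
    where
    open SetoidReasoning setoid
    open CommutativeMonoidSum +-commutativeMonoid
    open GroupProperties +-group using (identityʳ-unique; //-rightDividesˡ; //-rightDividesʳ)
    π = permute (_+ 1#) (_- 1#) +-congʳ +-congʳ (//-rightDividesˡ 1#) (//-rightDividesʳ 1#)

  -- Factors p · 1 are split off pᵐ · 1 = 0 one at a time. In a field one of the factors vanishes,
  -- and what would be left at m = 0 is 1.
  characteristic : ∀ p m → q ≡ p ℕ.^ m → p ×ᴿ 1# ≈ 0#
  characteristic p m ≡.refl = descend m q×1≈0
    where
    descend : ∀ m → (p ℕ.^ m) ×ᴿ 1# ≈ 0# → p ×ᴿ 1# ≈ 0#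
    descend zero    e = contradiction (trans (sym (×-homo-1 1#)) e) 1≉0
    descend (suc m) e with (p ×ᴿ 1#) ≟ 0#
    ... | yes p≈0 = p≈0
    ... | no  p≉0 = descend m (*-cancelʳ-0 p≉0
      (trans (*-comm _ _) (trans (sym (×1-homo-* p (p ℕ.^ m))) e)))

  open CommutativeMonoidSum *-commutativeMonoid using () renaming
    ( sum to product; sum-remove to product-remove; sum-cong-≋ to product-cong
    ; sum-replicate to product-replicate; sum-permute to product-permute
    ; ∑-distrib-+ to product-distrib )

  -- The product is the power of `a` with exponent n - 1; the extra factor avoids subtraction in the
  -- exponent.
  *-product-except : ∀ {n a} (v : Vector Carrier n) i → v i ≈ 1# → (∀ j → j ≢ i → v j ≈ a) →
                     a * product v ≈ a ^ n
  *-product-except {suc n} {a} v i vi≈1 v≈a = *-congˡ (begin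
    product v                        ≈⟨ product-remove {n} {i} v ⟩
    v i * product (removeAt v i)     ≈⟨ *-cong vi≈1 (product-cong λ j → v≈a _ (Fin.punchInᵢ≢i i j)) ⟩
    1# * product (replicate n a)     ≈⟨ *-identityˡ _ ⟩
    product (replicate n a)          ≈⟨ product-replicate n ⟩
    a ^ n                            ∎)
    where open SetoidReasoning setoid

  product≉0 : ∀ {n} (v : Vector Carrier n) → (∀ i → v i ≉ 0#) → product v ≉ 0#
  product≉0 {zero}  v v≉0 = 1≉0
  product≉0 {suc n} v v≉0 e =
    v≉0 zero (*-cancelʳ-0 (product≉0 (v ∘ suc) (v≉0 ∘ suc)) e)

  0^n≈0 : ∀ {n} → Fin n → 0# ^ n ≈ 0#
  0^n≈0 {suc n} _ = zeroˡ _

  -- Multiplication by a permutes the nonzero elements, so a scales their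
  -- product by 1; zero is kept in the index set but contributes a factor 1.
  ^q≈ : ∀ a → a ^ q ≈ a
  ^q≈ a with a ≟ 0#
  ... | yes a≈0 = trans (^-congˡ q a≈0) (trans (0^n≈0 (index 0#)) (sym a≈0))
    where open Exp semiring using (^-congˡ)
  ... | no a≉0 with inverse a a≉0
  ... | a⁻¹ , a⁻¹a≈1 = begin
    a ^ q                      ≈⟨ *-product-except (v ∘ element) (index 0#) (v-zero (element-index 0#))
                                    (λ j j≢0 → v-nonzero λ e → j≢0 (element-injective (trans e (sym (element-index 0#))))) ⟨
    a * product (v ∘ element)  ≈⟨ *-congˡ (*-cancelʳ (product≉0 _ λ i → w≉0 (element i)) (trans scaled (sym (*-identityˡ _)))) ⟩
    a * 1#                     ≈⟨ *-identityʳ a ⟩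
    a                          ∎
    where
    open SetoidReasoning setoid

    v w : Carrier → Carrier
    v x with x ≟ 0#
    ... | yes _ = 1#
    ... | no  _ = a
    w x with x ≟ 0#
    ... | yes _ = 1#
    ... | no  _ = x

    v-zero : ∀ {x} → x ≈ 0# → v x ≈ 1#
    v-zero {x} x≈0 with x ≟ 0#
    ... | yes _  = refl
    ... | no x≉0 = contradiction x≈0 x≉0

    v-nonzero : ∀ {x} → x ≉ 0# → v x ≈ a
    v-nonzero {x} x≉0 with x ≟ 0#
    ... | yes x≈0 = contradiction x≈0 x≉0
    ... | no  _   = refl

    w≉0 : ∀ x → w x ≉ 0#
    w≉0 x with x ≟ 0#
    ... | yes _  = 1≉0
    ... | no x≉0 = x≉0

    w-* : ∀ {x y} → y ≈ a * x → w y ≈ v x * w x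
    w-* {x} {y} y≈ax with x ≟ 0# | y ≟ 0#
    ... | yes _   | yes _   = sym (*-identityˡ 1#)
    ... | yes x≈0 | no y≉0  = contradiction (trans y≈ax (trans (*-congˡ x≈0) (zeroʳ a))) y≉0
    ... | no x≉0  | yes y≈0 = contradiction (*-cancelʳ-0 x≉0 (trans (sym y≈ax) y≈0)) a≉0
    ... | no _    | no _    = y≈ax

    cancel : ∀ {b c} → b * c ≈ 1# → ∀ x → b * (c * x) ≈ x
    cancel bc≈1 x = trans (sym (*-assoc _ _ x)) (trans (*-congʳ bc≈1) (*-identityˡ x))

    π = permute (a *_) (a⁻¹ *_) *-congˡ *-congˡ (cancel (trans (*-comm a a⁻¹) a⁻¹a≈1)) (cancel a⁻¹a≈1)

    scaled : product (v ∘ element) * product (w ∘ element) ≈ product (w ∘ element)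
    scaled = begin
      product (v ∘ element) * product (w ∘ element)    ≈⟨ product-distrib (v ∘ element) (w ∘ element) ⟨
      product (λ i → v (element i) * w (element i))    ≈⟨ product-cong (λ i → w-* {element i} (element-index (a * element i))) ⟨
      product (λ i → w (element (π ⟨$⟩ʳ i)))           ≈⟨ product-permute (w ∘ element) π ⟨
      product (w ∘ element)                            ∎

-- The fixed field of the q-power map

module FixedField {c ℓ₁ ℓ₂ c′ ℓ₁′ ℓ₂′ q Q} {K : FiniteField c ℓ₁ ℓ₂ q} {L : FiniteField c′ ℓ₁′ ℓ₂′ Q}
                  (E : FieldExtension K L) where

  open FieldExtension E
  open IsRingMonomorphism isRingMonomorphism using (isRingHomomorphism; injective; ⟦⟧-cong)
  private
    module K where
      open FiniteField K public
      open FiniteFieldProperties K public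
    module L where
      open FiniteField L public
      open FiniteFieldProperties L public
      open Polynomials rawRing public
      open PolynomialRing commutativeRing public
      open Degree commutativeRing public
      open FieldPolynomials commutativeRing isDecidableField public
    module R[x] = CommutativeRing L.polyRing
  open Exp (CommutativeRing.semiring L.commutativeRing) using (_^_)
  open Exp R[x].semiring using () renaming (_^_ to _^ₚ_)
  open CommutativeRing L.commutativeRing using (setoid)

  ι-fixed : ∀ a → ι a ^ q L.≈ ι a
  ι-fixed a = L.trans (L.sym (^-homo a q)) (⟦⟧-cong (K.^q≈ a))
    where open RingHomomorphismProperties K.commutativeRing L.commutativeRing ι isRingHomomorphism

  private
    Xq-X : L.Poly
    Xq-X = L.X ^ₚ q R[x].- L.X

    below : L.Below (suc q) Xq-X
    below = L.below-+ (L.X ^ₚ q) (R[x].- L.X)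
      (λ i q<i → L.coeff-Xⁿ-≢ q i (ℕ.>⇒≢ q<i))
      (L.below-neg L.X (L.below-weaken L.X (ℕ.m≤n⇒m≤1+n K.1<q) (L.below-length L.X)))

    -- The linear coefficient is -1, as 1 < q.
    Xq-X≉0 : ¬ Xq-X L.≈ₚ []
    Xq-X≉0 e = L.1≉0 (begin
      L.1#                     ≈⟨ GroupProperties.⁻¹-involutive +-group L.1# ⟨
      L.- (L.- L.1#)           ≈⟨ L.-‿cong (L.trans (L.+-congʳ (L.coeff-Xⁿ-≢ q 1 (ℕ.<⇒≢ K.1<q))) (L.+-identityˡ _)) ⟨
      L.- (L.coeff (L.X ^ₚ q) 1 L.+ L.- L.1#)
                               ≈⟨ L.-‿cong (L.coeff-+ (L.X ^ₚ q) (R[x].- L.X) 1) ⟨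
      L.- L.coeff Xq-X 1       ≈⟨ L.-‿cong (L.coeff-≈ e 1) ⟩
      L.- L.0#                 ≈⟨ RingProperties.-0#≈0# ring ⟩
      L.0#                     ∎)
      where
      open SetoidReasoning setoid
      open CommutativeRing L.commutativeRing using (ring; +-group)

    eval-Xq-X : ∀ {y} → y ^ q L.≈ y → L.eval Xq-X y L.≈ L.0#
    eval-Xq-X {y} yq≈y = begin
      L.eval Xq-X y                                          ≈⟨ L.eval-+ y (L.X ^ₚ q) (R[x].- L.X) ⟩
      L.eval (L.X ^ₚ q) y L.+ L.eval (R[x].- L.X) y          ≈⟨ L.+-congʳ (L.trans (L.eval-Xⁿ q y)
                                                                  (L.trans yq≈y (L.sym (L.eval-X y)))) ⟩
      L.eval L.X y L.+ L.eval (R[x].- L.X) y                 ≈⟨ L.eval-+ y L.X (R[x].- L.X) ⟨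
      L.eval (L.X L.+ₚ (R[x].- L.X)) y                       ≈⟨ L.eval-zero y (R[x].-‿inverseʳ L.X) ⟩
      L.0#                                                   ∎
      where open SetoidReasoning setoid

  -- A search through K decides whether `y` is in the image. If it were not, `y` and the q distinct
  -- images would be q + 1 roots of the nonzero polynomial xᵠ - x of degree at most q.
  fixed⇒ι : ∀ y → y ^ q L.≈ y → ∃[ a ] ι a L.≈ y
  fixed⇒ι y yq≈y with Fin.any? (λ i → ι (K.element i) L.≟ y)
  ... | yes (i , e) = K.element i , e
  ... | no ∄a       = contradiction (L.root-bound Xq-X below x x-injective x-root) Xq-X≉0
    where
    x : Fin (suc q) → L.Carrier
    x zero    = y
    x (suc i) = ι (K.element i)

    x-injective : ∀ i j → x i L.≈ x j → i ≡ j
    x-injective zero    zero    e = ≡.refl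
    x-injective zero    (suc j) e = contradiction (j , L.sym e) ∄a
    x-injective (suc i) zero    e = contradiction (i , e) ∄a
    x-injective (suc i) (suc j) e = ≡.cong suc (K.element-injective (injective e))

    x-root : ∀ i → L.eval Xq-X (x i) L.≈ L.0#
    x-root zero    = eval-Xq-X yq≈y
    x-root (suc i) = eval-Xq-X (ι-fixed (K.element i))

-- q-polynomials and the Frobenius action

module Spread {c ℓ} (R : CommutativeRing c ℓ) where

  open CommutativeRing R hiding (zero)
  open Polynomials rawRing
  open PolynomialRing R
  open Sum (CommutativeRing.semiring polyRing) using (sum)

  -- `φ` with an arbitrary exponent sequence. The exponents in the tail of φ(f) start at q instead
  -- of 1, so the tail is not φ of a list; with `e` free, inductions pass to `e ∘ suc`.
  spread : (ℕ → ℕ) → Poly → Poly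
  spread e f = sum (λ i → monomial (List.lookup f i) (e (toℕ i)))

  coeff-spread-0 : ∀ {j} e f → (∀ i → coeff f i ≈ 0# ⊎ e i ≢ j) → coeff (spread e f) j ≈ 0#
  coeff-spread-0 {j} e []      p = refl
  coeff-spread-0 {j} e (a ∷ f) p = trans (coeff-+ (monomial a (e 0)) _ j)
    (trans (+-cong (head≈0 (p 0)) (coeff-spread-0 (e ∘ suc) f (p ∘ suc))) (+-identityˡ 0#))
    where
    head≈0 : a ≈ 0# ⊎ e 0 ≢ j → coeff (monomial a (e 0)) j ≈ 0#
    head≈0 (inj₁ a≈0)  = trans (coeff-monomial a (e 0) j) (trans (*-congʳ a≈0) (zeroˡ _))
    head≈0 (inj₂ e₀≢j) = trans (coeff-monomial a (e 0) j)
      (trans (*-congˡ (coeff-Xⁿ-≢ (e 0) j (e₀≢j ∘ ≡.sym))) (zeroʳ a))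

  coeff-spread : ∀ e f d → (∀ i → e i ≡ e d → i ≡ d) → coeff (spread e f) (e d) ≈ coeff f d
  coeff-spread e []      d       e-inj = refl
  coeff-spread e (a ∷ f) zero    e-inj = trans (coeff-+ (monomial a (e 0)) _ (e 0)) (trans
    (+-cong (trans (coeff-monomial a (e 0) (e 0)) (trans (*-congˡ (coeff-Xⁿ-≡ (e 0))) (*-identityʳ a)))
            (coeff-spread-0 (e ∘ suc) f λ i → inj₂ λ p → contradiction (e-inj (suc i) p) λ ()))
    (+-identityʳ a))
  coeff-spread e (a ∷ f) (suc d) e-inj = trans (coeff-+ (monomial a (e 0)) _ (e (suc d))) (trans
    (+-cong (trans (coeff-monomial a (e 0) _) (trans
              (*-congˡ (coeff-Xⁿ-≢ (e 0) _ λ p → contradiction (e-inj 0 (≡.sym p)) λ ())) (zeroʳ a)))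
            (coeff-spread (e ∘ suc) f d λ i p → ℕ.suc-injective (e-inj (suc i) p)))
    (+-identityˡ _))

-- R[x] acts on S, with x acting as the q-power map.
module FrobeniusAction {a ℓ₁ b ℓ₂} (R : CommutativeRing a ℓ₁) (S : CommutativeRing b ℓ₂)
  (ψ : CommutativeRing.Carrier R → CommutativeRing.Carrier S)
  (ψ-hom : IsRingHomomorphism (CommutativeRing.rawRing R) (CommutativeRing.rawRing S) ψ)
  (q : ℕ) (σ : CommutativeRing.Carrier S → CommutativeRing.Carrier S)
  (σ≡^q : ∀ x → σ x ≡ Exp._^_ (CommutativeRing.semiring S) x q)
  (σ-hom : IsRingHomomorphism (CommutativeRing.rawRing S) (CommutativeRing.rawRing S) σ)
  (ψ-fixed : ∀ x → CommutativeRing._≈_ S (σ (ψ x)) (ψ x)) where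

  private
    module R where
      open CommutativeRing R public
      open Polynomials rawRing public
      open PolynomialRing R public
    module S where
      open CommutativeRing S public
      open Polynomials rawRing public
      open PolynomialRing S public
    module S[x] = CommutativeRing S.polyRing
    module R[x] = CommutativeRing R.polyRing
  open IsRingHomomorphism σ-hom using (⟦⟧-cong)
  open PolynomialMap R S ψ ψ-hom
  open TwistedEvaluation S σ σ-hom
  open Spread R
  open Exp S.semiring using (_^_; ^-congˡ; ^-assocʳ)
  open Exp R[x].semiring using () renaming (_^_ to _^ₚ_)

  infixr 8 _⊙_

  _⊙_ : R.Poly → S.Carrier → S.Carrier
  f ⊙ β = T (List.map ψ f) β

  ⊙-cong : ∀ {f g β γ} → f R.≈ₚ g → β S.≈ γ → f ⊙ β S.≈ g ⊙ γ
  ⊙-cong e p = T-cong (map-cong e) p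

  ⊙-+ : ∀ f g β → (f R.+ₚ g) ⊙ β S.≈ f ⊙ β S.+ g ⊙ β
  ⊙-+ f g β = S.trans (T-cong (map-+ f g) S.refl) (T-+ (List.map ψ f) (List.map ψ g) β)

  ⊙-neg : ∀ f β → (R[x].- f) ⊙ β S.≈ S.- (f ⊙ β)
  ⊙-neg f β = S.trans (T-cong (map-neg f) S.refl) (T-neg (List.map ψ f) β)

  ⊙-1 : ∀ β → R.const R.1# ⊙ β S.≈ β
  ⊙-1 β = S.trans (T-cong map-1 S.refl) (T-1 β)

  ⊙-zeroʳ : ∀ f {β} → β S.≈ S.0# → f ⊙ β S.≈ S.0#
  ⊙-zeroʳ f = T-zeroʳ (List.map ψ f)

  map-ψ-fixed : ∀ f → Fixed (List.map ψ f)
  map-ψ-fixed f i = S.trans (⟦⟧-cong (coeff-map f i)) (S.trans (ψ-fixed _) (S.sym (coeff-map f i)))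

  ⊙-* : ∀ f g β → (f R.*ₚ g) ⊙ β S.≈ f ⊙ g ⊙ β
  ⊙-* f g β = S.trans (T-cong (map-* f g) S.refl)
    (T-* (List.map ψ f) (List.map ψ g) (map-ψ-fixed g) β)

  ⊙-*-comm : ∀ f g β → f ⊙ g ⊙ β S.≈ g ⊙ f ⊙ β
  ⊙-*-comm f g β = S.trans (S.sym (⊙-* f g β)) (S.trans (⊙-cong (R.*ₚ-comm f g) S.refl) (⊙-* g f β))

  map-monomial : ∀ a k → List.map ψ (R.monomial a k) S.≈ₚ S.monomial (ψ a) k
  map-monomial a k = S[x].trans (map-* (R.const a) (R.X ^ₚ k)) (S.*ₚ-congˡ (S.const (ψ a)) (map-Xⁿ k))

  private
    -- The two points are kept apart because the inductive step replaces γ by σ(γ) and `e` by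
    -- `e ∘ suc` while β stays; the hypothesis relating their powers survives this change.
    eval-spread-∘ : ∀ e f {β γ} → (∀ i → β ^ e i S.≈ γ ^ (q ℕ.^ i)) →
                    S.eval (List.map ψ (spread e f)) β S.≈ f ⊙ γ
    eval-spread-∘ e []      p = S.refl
    eval-spread-∘ e (a ∷ f) {β} {γ} p = begin
      S.eval (List.map ψ (R.monomial a (e 0) R.+ₚ spread (e ∘ suc) f)) β
        ≈⟨ S.eval-cong (map-+ (R.monomial a (e 0)) (spread (e ∘ suc) f)) S.refl ⟩
      S.eval (List.map ψ (R.monomial a (e 0)) S.+ₚ List.map ψ (spread (e ∘ suc) f)) β
        ≈⟨ S.eval-+ β (List.map ψ (R.monomial a (e 0))) _ ⟩
      S.eval (List.map ψ (R.monomial a (e 0))) β S.+ S.eval (List.map ψ (spread (e ∘ suc) f)) β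
        ≈⟨ S.+-cong
             (S.trans (S.eval-cong (map-monomial a (e 0)) S.refl)
               (S.trans (S.eval-monomial (ψ a) (e 0) β) (S.*-congˡ (S.trans (p 0) (S.*-identityʳ γ)))))
             (eval-spread-∘ (e ∘ suc) f p′) ⟩
      ψ a S.* γ S.+ f ⊙ σ γ ∎
      where
      open SetoidReasoning S.setoid
      p′ : ∀ i → β ^ e (suc i) S.≈ σ γ ^ (q ℕ.^ i)
      p′ i = S.trans (p (suc i)) (S.trans (S.sym (^-assocʳ γ q (q ℕ.^ i)))
        (^-congˡ (q ℕ.^ i) (S.reflexive (≡.sym (σ≡^q γ)))))

  eval-spread : ∀ f β → S.eval (List.map ψ (spread (q ℕ.^_) f)) β S.≈ f ⊙ β
  eval-spread f β = eval-spread-∘ (q ℕ.^_) f λ i → S.refl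

-- Composition of polynomials

module Composition {c ℓ} (R : CommutativeRing c ℓ) where

  open CommutativeRing R hiding (zero)
  open Polynomials rawRing
  open PolynomialRing R
  private
    module R[x] = CommutativeRing polyRing
    module R[x][y] where
      open Polynomials R[x].rawRing public
      open PolynomialRing polyRing public

  const-isRingHomomorphism : IsRingHomomorphism rawRing R[x].rawRing const
  const-isRingHomomorphism = record
    { isSemiringHomomorphism = record
      { isNearSemiringHomomorphism = record
        { +-isMonoidHomomorphism = record
          { isMagmaHomomorphism = record
            { isRelHomomorphism = record { cong = λ e → ∷-cong e R[x].refl }
            ; homo              = λ a b → R[x].refl
            }
          ; ε-homo = 0∷[]≈[]
          }
        ; *-homo = λ a b → ∷-cong (sym (+-identityʳ _)) R[x].refl
        }
      ; 1#-homo = R[x].refl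
      }
    ; -‿homo = λ a → R[x].refl
    }

  open PolynomialMap R polyRing const const-isRingHomomorphism using (map-cong)

  -- Viewing composition as evaluation over R[x] makes the results on evaluation apply to it,
  -- including those on the Frobenius action.
  ∘≡eval : ∀ f g → f ∘ₚ g ≡ R[x][y].eval (List.map const f) g
  ∘≡eval []      g = ≡.refl
  ∘≡eval (a ∷ f) g = ≡.cong (λ h → const a +ₚ g *ₚ h) (∘≡eval f g)

  ∘-cong : ∀ {f f′ g g′} → f ≈ₚ f′ → g ≈ₚ g′ → f ∘ₚ g ≈ₚ f′ ∘ₚ g′
  ∘-cong {f} {f′} {g} {g′} p r
    rewrite ∘≡eval f g | ∘≡eval f′ g′ = R[x][y].eval-cong (map-cong p) r

  ∘-X : ∀ f → f ∘ₚ X ≈ₚ f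
  ∘-X []      = R[x].refl
  ∘-X (a ∷ f) = R[x].trans
    (+ₚ-cong {const a} R[x].refl (R[x].trans (*ₚ-congˡ X (∘-X f)) (X-*ₚ f)))
    (∷-cong (+-identityʳ a) R[x].refl)

-- Comaximal elements and divisibility by products

module Comaximality {c ℓ} (R : CommutativeRing c ℓ) where

  open CommutativeRing R hiding (zero)
  open SemiringDivisibility semiring

  Comaximal : Carrier → Carrier → Set (c ⊔ ℓ)
  Comaximal x y = ∃₂ λ u v → u * x + v * y ≈ 1#

  comaximal-1 : ∀ x → Comaximal x 1#
  comaximal-1 x = 0# , 1# , trans (+-cong (zeroˡ x) (*-identityˡ 1#)) (+-identityˡ 1#)

  -- Multiply the two relations: every term except the one in y z contains x.
  comaximal-* : ∀ {x y z} → Comaximal x y → Comaximal x z → Comaximal x (y * z)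
  comaximal-* {x} {y} {z} (u , v , e) (u′ , v′ , e′) =
    (u * u′ * x + u * v′ * z + v * u′ * y) , v * v′ , (begin
      (u * u′ * x + u * v′ * z + v * u′ * y) * x + v * v′ * (y * z)
        ≈⟨ solve 7 (λ x y z u v u′ v′ →
             (u :* u′ :* x :+ u :* v′ :* z :+ v :* u′ :* y) :* x :+ v :* v′ :* (y :* z)
             := (u :* x :+ v :* y) :* (u′ :* x :+ v′ :* z)) refl x y z u v u′ v′ ⟩
      (u * x + v * y) * (u′ * x + v′ * z)   ≈⟨ *-cong e e′ ⟩
      1# * 1#                               ≈⟨ *-identityˡ 1# ⟩
      1#                                    ∎)
    where
    open SetoidReasoning setoid
    open SemiringSolver commutativeSemiring

  -- In z = u x z + v y z, write the first z as a multiple of y and the second as a multiple of x.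
  comaximal-∣ : ∀ {x y z} → Comaximal x y → x ∣ z → y ∣ z → x * y ∣ z
  comaximal-∣ {x} {y} {z} (u , v , e) (k ,∣ kx≈z) (l ,∣ ly≈z) = (u * l + v * k) ,∣ (begin
    (u * l + v * k) * (x * y)               ≈⟨ solve 6 (λ x y u v k l →
      (u :* l :+ v :* k) :* (x :* y) := u :* x :* (l :* y) :+ v :* y :* (k :* x)) refl x y u v k l ⟩
    u * x * (l * y) + v * y * (k * x)       ≈⟨ +-cong (*-congˡ ly≈z) (*-congˡ kx≈z) ⟩
    u * x * z + v * y * z                   ≈⟨ distribʳ z _ _ ⟨
    (u * x + v * y) * z                     ≈⟨ *-congʳ e ⟩
    1# * z                                  ≈⟨ *-identityˡ z ⟩
    z                                       ∎)
    where
    open SetoidReasoning setoid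
    open SemiringSolver commutativeSemiring

  ∏[_]_ : ∀ {s} → Subset s → Vector Carrier s → Carrier
  ∏[ S ] v = foldOver _*_ 1# S v

  ∏-comaximal : ∀ {s x} (S : Subset s) v → (∀ i → Comaximal x (v i)) → Comaximal x (∏[ S ] v)
  ∏-comaximal []            v p = comaximal-1 _
  ∏-comaximal (inside  ∷ S) v p = comaximal-* (p zero) (∏-comaximal S (v ∘ suc) (p ∘ suc))
  ∏-comaximal (outside ∷ S) v p = ∏-comaximal S (v ∘ suc) (p ∘ suc)

  ∏-∣ : ∀ {s x} (S : Subset s) v → (∀ i j → i ≢ j → Comaximal (v i) (v j)) →
        (∀ {i} → i ∈ S → v i ∣ x) → ∏[ S ] v ∣ x
  ∏-∣ {x = x} []    v _  p = x ,∣ *-identityʳ x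
  ∏-∣ (inside  ∷ S) v cm p = comaximal-∣
    (∏-comaximal S (v ∘ suc) λ j → cm zero (suc j) λ ())
    (p here)
    (∏-∣ S (v ∘ suc) (λ i j i≢j → cm (suc i) (suc j) (i≢j ∘ Fin.suc-injective)) (p ∘ there))
  ∏-∣ (outside ∷ S) v cm p =
    ∏-∣ S (v ∘ suc) (λ i j i≢j → cm (suc i) (suc j) (i≢j ∘ Fin.suc-injective)) (p ∘ there)

  ∈⇒∣∏ : ∀ {s} {S : Subset s} v {i} → i ∈ S → v i ∣ ∏[ S ] v
  ∈⇒∣∏ {S = inside  ∷ S} v here      = ∏[ S ] (v ∘ suc) ,∣ *-comm _ _
  ∈⇒∣∏ {S = inside  ∷ S} v (there p) = x∣ʳy⇒x∣ʳzy (v zero) (∈⇒∣∏ (v ∘ suc) p)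
  ∈⇒∣∏ {S = outside ∷ S} v (there p) = ∈⇒∣∏ (v ∘ suc) p

-- Multiplication by the orbit polynomial

module CyclicConvolution {c ℓ} (R : CommutativeRing c ℓ)
  (σ : CommutativeRing.Carrier R → CommutativeRing.Carrier R)
  (σ-hom : IsRingHomomorphism (CommutativeRing.rawRing R) (CommutativeRing.rawRing R) σ) where

  open CommutativeRing R hiding (zero)
  open Polynomials rawRing
  open PolynomialRing R
  open Degree R using (Below)
  open TwistedEvaluation R σ σ-hom
  private
    module R[x] = CommutativeRing polyRing
  open Exp R[x].semiring using (_^_)
  open Sum R[x].semiring using (sum)

  -- t 0 xⁿ⁻¹ + t 1 xⁿ⁻² + ⋯ + t (n - 1).
  window : (ℕ → Carrier) → ℕ → Poly
  window t zero    = []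
  window t (suc n) = t n ∷ window t n

  window-below : ∀ t n → Below n (window t n)
  window-below t zero    i       _         = refl
  window-below t (suc n) (suc i) (s≤s n≤i) = window-below t n i n≤i

  window-cong : ∀ {t u} n → (∀ i → i < n → t i ≈ u i) → window t n ≈ₚ window u n
  window-cong zero    e = R[x].refl
  window-cong (suc n) e = ∷-cong (e n ℕ.≤-refl) (window-cong n λ i i<n → e i (ℕ.m<n⇒m<1+n i<n))

  window-zero : ∀ {t} n → window t n ≈ₚ [] → ∀ i → i < n → t i ≈ 0#
  window-zero (suc n) e i (s≤s i≤n) with ℕ.m≤n⇒m<n∨m≡n i≤n
  ... | inj₁ i<n    = window-zero n (mk≈ₚ λ i → coeff-≈ e (suc i)) i i<n
  ... | inj₂ ≡.refl = coeff-≈ e 0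

  window-0 : ∀ n → window (λ _ → 0#) n ≈ₚ []
  window-0 zero    = R[x].refl
  window-0 (suc n) = ∷-zero refl (window-0 n)

  window-+ : ∀ t u n → window (λ i → t i + u i) n ≈ₚ window t n +ₚ window u n
  window-+ t u zero    = R[x].refl
  window-+ t u (suc n) = ∷-cong refl (window-+ t u n)

  window-· : ∀ a t n → window (λ i → a * t i) n ≈ₚ a · window t n
  window-· a t zero    = R[x].refl
  window-· a t (suc n) = ∷-cong refl (window-· a t n)

  monomial-suc : ∀ a n → monomial a (suc n) ≈ₚ 0# ∷ monomial a n
  monomial-suc a n = mk≈ₚ λ
    { zero    → trans (coeff-monomial a (suc n) 0) (trans (*-congˡ (coeff-Xⁿ-≢ (suc n) 0 λ ())) (zeroʳ a))
    ; (suc i) → trans (coeff-monomial a (suc n) (suc i)) (trans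
        (*-congˡ (coeff-≈ (X-*ₚ (X ^ n)) (suc i))) (sym (coeff-monomial a n i))) }

  -- `window` unfolds at its constant term, whereas the sum defining `g` and the multiplication by x
  -- split off the leading one.
  window-suc : ∀ t n → window t (suc n) ≈ₚ monomial (t 0) n +ₚ window (t ∘ suc) n
  window-suc t zero    = R[x].sym (R[x].trans (+ₚ-identityʳ _) (R[x].*-identityʳ (const (t 0))))
  window-suc t (suc n) = R[x].trans
    (∷-cong (sym (+-identityˡ _)) (window-suc t n))
    (R[x].sym (R[x].+-congʳ {t (suc n) ∷ window (t ∘ suc) n} (monomial-suc (t 0) n)))

  sum-monomials : ∀ t n → sum {n} (λ i → monomial (t (toℕ i)) (n ∸ toℕ i ∸ 1)) ≈ₚ window t n
  sum-monomials t zero    = R[x].refl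
  sum-monomials t (suc n) = R[x].trans
    (R[x].+-congˡ {monomial (t 0) n} (sum-monomials (t ∘ suc) n)) (R[x].sym (window-suc t n))

  -- The polynomial part of f(x) · Σ σⁱ(α) x⁻ⁱ⁻¹.
  polynomialPart : Poly → Carrier → Poly
  polynomialPart []      α = []
  polynomialPart (a ∷ f) α = T f α ∷ polynomialPart f α

  orbit : Carrier → ℕ → Carrier
  orbit α i = σ^ i α

  orbitT : Poly → Carrier → ℕ → Carrier
  orbitT f α i = T f (orbit α i)

  -- Since σⁿ(α) = α, the window of the orbit is (xⁿ - 1) · Σ σⁱ(α) x⁻ⁱ⁻¹;
  -- the coefficient of x⁻ⁱ⁻¹ in f(x) · Σ σⁱ(α) x⁻ⁱ⁻¹ is T f (σⁱ(α)).
  *-window-orbit : ∀ {n α} → σ^ n α ≈ α → ∀ f → f *ₚ window (orbit α) n ≈ₚ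
                   polynomialPart f α *ₚ Xⁿ-1 n +ₚ window (orbitT f α) n
  *-window-orbit {n} _ [] = R[x].sym (window-0 n)
  *-window-orbit {n} {α} σⁿα≈α (a ∷ f) = begin
    a · G +ₚ (0# ∷ f *ₚ G)
      ≈⟨ R[x].+-congˡ {a · G} (∷-cong (sym (+-identityˡ 0#)) (*-window-orbit σⁿα≈α f)) ⟩
    a · G +ₚ ((0# ∷ Q *ₚ N) +ₚ (0# ∷ window t n))
      ≈⟨ R[x].+-congˡ {a · G} (R[x].+-congˡ {0# ∷ Q *ₚ N} shift) ⟩
    a · G +ₚ ((0# ∷ Q *ₚ N) +ₚ (t 0 · N +ₚ window (t ∘ suc) n))
      ≈⟨ solve 4 (λ x y z w → x :+ (y :+ (z :+ w)) := (z :+ y) :+ (x :+ w)) R[x].refl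
           (a · G) (0# ∷ Q *ₚ N) (t 0 · N) (window (t ∘ suc) n) ⟩
    (t 0 · N +ₚ (0# ∷ Q *ₚ N)) +ₚ (a · G +ₚ window (t ∘ suc) n)
      ≈⟨ R[x].+-congˡ {t 0 · N +ₚ (0# ∷ Q *ₚ N)} tail ⟨
    (t 0 · N +ₚ (0# ∷ Q *ₚ N)) +ₚ window (orbitT (a ∷ f) α) n ∎
    where
    open SetoidReasoning R[x].setoid
    open SemiringSolver R[x].commutativeSemiring
    G = window (orbit α) n
    N = Xⁿ-1 n
    Q = polynomialPart f α
    t = orbitT f α

    tail : window (orbitT (a ∷ f) α) n ≈ₚ a · G +ₚ window (t ∘ suc) n
    tail = R[x].trans
      (window-+ (λ i → a * orbit α i) (λ i → T f (σ (orbit α i))) n)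
      (R[x].+-cong (window-· a (orbit α) n)
        (window-cong n λ i _ → T-cong {f} R[x].refl (reflexive (σ-σ^ i α))))

    t₀·N : t 0 · N ≈ₚ monomial (t 0) n +ₚ R[x].- const (t 0)
    t₀·N = R[x].trans (·-distribˡ (t 0) (X ^ n) _)
      (R[x].+-cong (R[x].sym (const-*ₚ (t 0) (X ^ n)))
        (∷-cong (trans (sym (-‿distribʳ-* (t 0) 1#)) (-‿cong (*-identityʳ _))) R[x].refl))
      where open RingProperties ring using (-‿distribʳ-*)

    -- The shifted window has constant term t n, while x · `window t n` has leading term t 0 xⁿ and
    -- constant term 0. As t n = t 0 by periodicity, they differ by t 0 (xⁿ - 1).
    shift : 0# ∷ window t n ≈ₚ t 0 · N +ₚ window (t ∘ suc) n
    shift = begin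
      0# ∷ window t n
        ≈⟨ ∷-cong (trans (sym (-‿inverseˡ (t 0))) (+-congˡ (T-cong {f} R[x].refl (sym σⁿα≈α)))) R[x].refl ⟩
      R[x].- const (t 0) +ₚ window t (suc n)
        ≈⟨ R[x].+-congˡ {R[x].- const (t 0)} (window-suc t n) ⟩
      R[x].- const (t 0) +ₚ (monomial (t 0) n +ₚ window (t ∘ suc) n)
        ≈⟨ solve 3 (λ x y z → x :+ (y :+ z) := (y :+ x) :+ z) R[x].refl
             (R[x].- const (t 0)) (monomial (t 0) n) (window (t ∘ suc) n) ⟩
      (monomial (t 0) n +ₚ R[x].- const (t 0)) +ₚ window (t ∘ suc) n
        ≈⟨ R[x].+-congʳ {window (t ∘ suc) n} t₀·N ⟨
      t 0 · N +ₚ window (t ∘ suc) n ∎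

-- Annihilators of an orbit and Galois descent

module OrbitAnnihilator {c ℓ} (F : CommutativeRing c ℓ) (isField : IsDecidableField F)
  (σ : CommutativeRing.Carrier F → CommutativeRing.Carrier F)
  (σ-hom : IsRingHomomorphism (CommutativeRing.rawRing F) (CommutativeRing.rawRing F) σ) where

  open CommutativeRing F hiding (zero)
  open Polynomials rawRing
  open PolynomialRing F
  open Degree F
  open FieldPolynomials F isField
  open TwistedEvaluation F σ σ-hom
  open CyclicConvolution F σ σ-hom
  open IsRingHomomorphism σ-hom
  private
    module F[x] where
      open CommutativeRing polyRing public
      open SemiringDivisibility (CommutativeRing.semiring polyRing) public

  module Orbit (n : ℕ) (α : Carrier) (σⁿα≈α : σ^ (suc n) α ≈ α) where

    -- The orbit has period `suc n`, so these conjugates are all of them; the values are the entries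
    -- of `window (orbitT f α) (suc n)`.
    Annihilates : Poly → Set ℓ
    Annihilates f = ∀ i → i < suc n → T f (σ^ i α) ≈ 0#

    private
      G : Poly
      G = window (orbit α) (suc n)

    annihilates⇒∣ : ∀ f → Annihilates f → f *ₚ G ≈ₚ polynomialPart f α *ₚ Xⁿ-1 (suc n)
    annihilates⇒∣ f ann = F[x].trans (*-window-orbit σⁿα≈α f) (F[x].trans
      (F[x].+-congˡ {polynomialPart f α *ₚ Xⁿ-1 (suc n)}
        (F[x].trans (window-cong (suc n) ann) (window-0 (suc n))))
      (+ₚ-identityʳ _))

    -- The window W is the product f G minus a multiple of xⁿ⁺¹ - 1, hence itself such a multiple.
    -- Its degree is too small for that, so it vanishes.
    ∣⇒annihilates : ∀ f k → k *ₚ Xⁿ-1 (suc n) ≈ₚ f *ₚ G → Annihilates f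
    ∣⇒annihilates f k kN≈fG = window-zero (suc n) (begin
      W                          ≈⟨ difference ⟨
      (k F[x].- Q) *ₚ N          ≈⟨ *ₚ-cong k-Q≈0 (F[x].refl {N}) ⟩
      []                         ∎)
      where
      open SetoidReasoning F[x].setoid
      open GroupProperties F[x].+-group using (//-rightDividesʳ)
      N = Xⁿ-1 (suc n)
      Q = polynomialPart f α
      W = window (orbitT f α) (suc n)

      difference : (k F[x].- Q) *ₚ N ≈ₚ W
      difference = begin
        (k F[x].- Q) *ₚ N                        ≈⟨ RingProperties.[y-z]x≈yx-zx F[x].ring N k Q ⟩
        k *ₚ N F[x].- Q *ₚ N                     ≈⟨ F[x].+-congʳ {F[x].- (Q *ₚ N)} (F[x].trans kN≈fG
                                                      (F[x].trans (*-window-orbit σⁿα≈α f) (+ₚ-comm (Q *ₚ N) W))) ⟩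
        (W +ₚ Q *ₚ N) F[x].- Q *ₚ N              ≈⟨ //-rightDividesʳ (Q *ₚ N) W ⟩
        W                                        ∎

      k-Q≈0 : k F[x].- Q ≈ₚ []
      k-Q≈0 = multiple-below (k F[x].- Q) (proj₁ (hasDegreeMonic-Xⁿ-1 n))
        (below-cong (F[x].sym difference) (window-below (orbitT f α) (suc n)))

    annihilates-· : ∀ a f → Annihilates f → Annihilates (a · f)
    annihilates-· a f ann i i<n = trans (T-· a f _) (trans (*-congˡ (ann i i<n)) (zeroʳ a))

    annihilates-- : ∀ f g → Annihilates f → Annihilates g → Annihilates (f F[x].- g)
    annihilates-- f g annf anng i i<n = trans (T-+ f (F[x].- g) _) (trans
      (+-cong (annf i i<n) (trans (T-neg g _) (trans (-‿cong (anng i i<n)) -0#≈0#)))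
      (+-identityˡ 0#))
      where open RingProperties ring using (-0#≈0#)

    annihilates-cong : ∀ {f g} → f ≈ₚ g → Annihilates f → Annihilates g
    annihilates-cong f≈g ann i i<n = trans (T-cong (F[x].sym f≈g) refl) (ann i i<n)

    -- Applying σ to the value of `f` at one conjugate gives the value of the conjugated polynomial
    -- at the next. Index 0 is reached from the last index, because the orbit closes up.
    annihilates-σ : ∀ f → Annihilates f → Annihilates (List.map σ f)
    annihilates-σ f ann zero    _         = begin
      T (List.map σ f) α                ≈⟨ T-cong {List.map σ f} F[x].refl (trans (reflexive (σ-σ^ n α)) σⁿα≈α) ⟨
      T (List.map σ f) (σ (σ^ n α))     ≈⟨ σ-T f (σ^ n α) ⟨
      σ (T f (σ^ n α))                  ≈⟨ ⟦⟧-cong (ann n ℕ.≤-refl) ⟩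
      σ 0#                              ≈⟨ 0#-homo ⟩
      0#                                ∎
      where open SetoidReasoning setoid
    annihilates-σ f ann (suc i) (s≤s i<n) = begin
      T (List.map σ f) (σ^ i (σ α))     ≡⟨ ≡.cong (T (List.map σ f)) (σ-σ^ i α) ⟨
      T (List.map σ f) (σ (σ^ i α))     ≈⟨ σ-T f (σ^ i α) ⟨
      σ (T f (σ^ i α))                  ≈⟨ ⟦⟧-cong (ann i (ℕ.m<n⇒m<1+n i<n)) ⟩
      σ 0#                              ≈⟨ 0#-homo ⟩
      0#                                ∎
      where open SetoidReasoning setoid

    annihilates-multiple : ∀ k f → Fixed f → T f α ≈ 0# → Annihilates (k *ₚ f)
    annihilates-multiple k f fix Tfα≈0 i _ =
      trans (T-* k f fix _) (T-zeroʳ k (T-orbit i Tfα≈0))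
      where
      T-orbit : ∀ i {β} → T f β ≈ 0# → T f (σ^ i β) ≈ 0#
      T-orbit zero    e = e
      T-orbit (suc i) {β} e = T-orbit i (begin
        T f (σ β)                  ≈⟨ T-cong (map-fixed f fix) refl ⟨
        T (List.map σ f) (σ β)     ≈⟨ σ-T f β ⟨
        σ (T f β)                  ≈⟨ trans (⟦⟧-cong e) 0#-homo ⟩
        0#                         ∎)
        where open SetoidReasoning setoid

    -- Galois descent by induction on the degree: for r monic, σ r - r has
    -- smaller degree, so it vanishes and r has σ-fixed coefficients.
    annihilates-below : ∀ d → (∀ r → Fixed r → T r α ≈ 0# → Below d r → r ≈ₚ []) →
                        ∀ r → Below d r → Annihilates r → r ≈ₚ []
    annihilates-below zero    fixed⇒0 r r<0   ann = below-zero r r<0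
    annihilates-below (suc d) fixed⇒0 r r<1+d ann with IsDecidableField._≟_ isField (coeff r d) 0#
    ... | yes rd≈0 = annihilates-below d
      (λ r fix e r<d → fixed⇒0 r fix e (below-weaken r (ℕ.n≤1+n d) r<d)) r (below-pred r r<1+d rd≈0) ann
    ... | no rd≉0 with IsDecidableField.inverse isField _ rd≉0
    ... | u , urd≈1 = contradiction
        (trans (sym r′d≈1) (coeff-≈ (fixed⇒0 r′ r′-fixed (annr′ 0 (s≤s z≤n)) r′<1+d) d))
        (IsDecidableField.1≉0 isField)
      where
      open PolynomialMap F F σ σ-hom using (coeff-map)
      r′ = u · r
      s = List.map σ r′ F[x].- r′

      r′<1+d : Below (suc d) r′
      r′<1+d = below-· u r r<1+d

      r′d≈1 : coeff r′ d ≈ 1#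
      r′d≈1 = trans (coeff-· u r d) urd≈1

      annr′ : Annihilates r′
      annr′ = annihilates-· u r ann

      coeff-s : ∀ i → coeff s i ≈ σ (coeff r′ i) - coeff r′ i
      coeff-s i = trans (coeff-+ (List.map σ r′) _ i) (+-cong (coeff-map r′ i) (coeff-neg r′ i))

      s<d : Below d s
      s<d = below-pred s
        (below-+ (List.map σ r′) (F[x].- r′)
          (λ i d<i → trans (coeff-map r′ i) (trans (⟦⟧-cong (r′<1+d i d<i)) 0#-homo))
          (below-neg r′ r′<1+d))
        (trans (coeff-s d) (trans
          (+-cong (trans (⟦⟧-cong r′d≈1) 1#-homo) (-‿cong r′d≈1)) (-‿inverseʳ 1#)))

      s≈0 : s ≈ₚ []
      s≈0 = annihilates-below d
        (λ r fix e r<d → fixed⇒0 r fix e (below-weaken r (ℕ.n≤1+n d) r<d)) s s<d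
        (annihilates-- (List.map σ r′) r′ (annihilates-σ r′ annr′) annr′)

      r′-fixed : Fixed r′
      r′-fixed i = GroupProperties.x∙y⁻¹≈ε⇒x≈y +-group _ _ (trans (sym (coeff-s i)) (coeff-≈ s≈0 i))

    -- The remainder of `h` modulo `f` still annihilates the orbit, since multiples of `f` do, and
    -- descent excludes a nonzero one of degree below d.
    annihilates⇒multiple : ∀ {f d} → HasDegree f d → Fixed f → T f α ≈ 0# →
      (∀ r → Fixed r → T r α ≈ 0# → Below d r → r ≈ₚ []) →
      ∀ h → Annihilates h → f F[x].∣ h
    annihilates⇒multiple {f} {d} (fd≉0 , f<) fix Tfα≈0 fixed⇒0 h ann
      with IsDecidableField.inverse isField _ fd≉0
    ... | u , ufd≈1 with division f u f< ufd≈1 h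
    ... | k , r , h≈kf+r , r<d = k ,∣ (begin
        k *ₚ f             ≈⟨ +ₚ-identityʳ _ ⟨
        k *ₚ f +ₚ []       ≈⟨ F[x].+-congˡ {k *ₚ f} r≈0 ⟨
        k *ₚ f +ₚ r        ≈⟨ h≈kf+r ⟨
        h                  ∎)
      where
      open SetoidReasoning F[x].setoid
      open GroupProperties F[x].+-group using (//-rightDividesʳ)

      h-kf≈r : h F[x].- k *ₚ f ≈ₚ r
      h-kf≈r = begin
        h F[x].- k *ₚ f                   ≈⟨ F[x].+-congʳ {F[x].- (k *ₚ f)} (F[x].trans h≈kf+r (+ₚ-comm (k *ₚ f) r)) ⟩
        (r +ₚ k *ₚ f) F[x].- k *ₚ f       ≈⟨ //-rightDividesʳ (k *ₚ f) r ⟩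
        r                                 ∎

      r≈0 : r ≈ₚ []
      r≈0 = annihilates-below d fixed⇒0 r r<d (annihilates-cong h-kf≈r
        (annihilates-- h (k *ₚ f) ann (annihilates-multiple k f fix Tfα≈0)))

-- The action of K[x] on L and the map φ

module ConjugateAnnihilation {c ℓ₁ ℓ₂ c′ ℓ₁′ ℓ₂′ p m q n Q}
  (p-prime : Prime p) (q≡pᵐ : q ≡ p ℕ.^ m) (Q≡qⁿ : Q ≡ q ℕ.^ suc n)
  {K : FiniteField c ℓ₁ ℓ₂ q} {L : FiniteField c′ ℓ₁′ ℓ₂′ Q} (E : FieldExtension K L) where

  open FieldExtension E
  open IsRingMonomorphism isRingMonomorphism using (isRingHomomorphism; injective; ⟦⟧-cong; 0#-homo; 1#-homo)
  open Extension E
  private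
    module FK = FiniteFieldProperties K
    module FL = FiniteFieldProperties L
    module KR where
      open CommutativeRing K.commutativeRing public
      open PolynomialRing K.commutativeRing public
      open Degree K.commutativeRing public
      open FieldPolynomials K.commutativeRing FK.isDecidableField public
      open Composition K.commutativeRing public
      open Spread K.commutativeRing public
      open Comaximality (PolynomialRing.polyRing K.commutativeRing) public
    module LR where
      open CommutativeRing L.commutativeRing public
      open PolynomialRing L.commutativeRing public
      open Degree L.commutativeRing public
      open FieldPolynomials L.commutativeRing FL.isDecidableField public
    module KX where
      open CommutativeRing KR.polyRing public
      open SemiringDivisibility (CommutativeRing.semiring KR.polyRing) public
    module LX where
      open CommutativeRing LR.polyRing public
      open SemiringDivisibility (CommutativeRing.semiring LR.polyRing) public
  open Exp LR.semiring using (^-congʳ; ^-assocʳ) renaming (_^_ to _^ᴸ_)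
  open Exp KX.semiring using () renaming (_^_ to _^ₚ_)
  open Mult KR.semiring using () renaming (_×_ to _×ᴷ_)

  p×1≈0 : p ×ᴷ KR.1# KR.≈ KR.0#
  p×1≈0 = FK.characteristic p m q≡pᵐ

  σ : LR.Carrier → LR.Carrier
  σ x = x ^ᴸ q

  σ-hom : IsRingHomomorphism LR.rawRing LR.rawRing σ
  σ-hom = Frobenius.frobenius-isRingHomomorphism L.commutativeRing p-prime
    (RingHomomorphismProperties.characteristic-homo K.commutativeRing L.commutativeRing
      ι isRingHomomorphism {p} p×1≈0)
    {m} q≡pᵐ

  open FixedField E using (ι-fixed; fixed⇒ι)
  open FrobeniusAction K.commutativeRing L.commutativeRing ι isRingHomomorphism
    q σ (λ _ → ≡.refl) σ-hom ι-fixed public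
  open PolynomialMap K.commutativeRing L.commutativeRing ι isRingHomomorphism
  open TwistedEvaluation L.commutativeRing σ σ-hom
  open CyclicConvolution L.commutativeRing σ σ-hom

  σ^≈^ : ∀ i β → σ^ i β LR.≈ β ^ᴸ (q ℕ.^ i)
  σ^≈^ zero    β = LR.sym (LR.*-identityʳ β)
  σ^≈^ (suc i) β = LR.trans (σ^≈^ i (σ β)) (^-assocʳ β q (q ℕ.^ i))

  -- The iterate is the Q-power map, which is the identity on a field with Q elements.
  σⁿ≈id : ∀ β → σ^ (suc n) β LR.≈ β
  σⁿ≈id β = LR.trans (σ^≈^ (suc n) β) (LR.trans (^-congʳ β (≡.sym Q≡qⁿ)) (FL.^q≈ β))

  Xⁿ-1-⊙ : ∀ β → K.Xⁿ-1 (suc n) ⊙ β LR.≈ LR.0#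
  Xⁿ-1-⊙ β = LR.trans (T-cong (map-Xⁿ-1 (suc n)) LR.refl) (LR.trans (T-Xⁿ-1 (suc n) β)
    (LR.trans (LR.+-congʳ (σⁿ≈id β)) (LR.-‿inverseʳ β)))

  -- K[x] acts on itself too, and φ f is the value of f on x.
  private
    module Self = FrobeniusAction K.commutativeRing KR.polyRing K.const KR.const-isRingHomomorphism
      q (_^ₚ q) (λ _ → ≡.refl)
      (Frobenius.frobenius-isRingHomomorphism KR.polyRing p-prime
        (RingHomomorphismProperties.characteristic-homo K.commutativeRing KR.polyRing
          K.const KR.const-isRingHomomorphism {p} p×1≈0) {m} q≡pᵐ)
      (λ a → KX.trans
        (KX.sym (RingHomomorphismProperties.^-homo K.commutativeRing KR.polyRing
          K.const KR.const-isRingHomomorphism a q))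
        (KR.∷-cong (FK.^q≈ a) KX.refl))

  φ-∘ : ∀ f h → φ f K.∘ₚ h K.≈ₚ f Self.⊙ h
  φ-∘ f h = KX.trans (KX.reflexive (KR.∘≡eval (φ f) h)) (Self.eval-spread f h)

  φ≈⊙X : ∀ f → φ f K.≈ₚ f Self.⊙ K.X
  φ≈⊙X f = KX.trans (KX.sym (KR.∘-X (φ f))) (φ-∘ f K.X)

  -- `φ` sums over the entries of a list, so its indifference to trailing zeros is not immediate; it
  -- is inherited from the action on x.
  φ-cong : ∀ {f g} → f K.≈ₚ g → φ f K.≈ₚ φ g
  φ-cong {f} {g} e = KX.trans (φ≈⊙X f) (KX.trans (Self.⊙-cong e KX.refl) (KX.sym (φ≈⊙X g)))

  φ-* : ∀ f g → φ (f K.*ₚ g) K.≈ₚ φ f ⊗ φ g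
  φ-* f g = begin
    φ (f K.*ₚ g)                  ≈⟨ φ≈⊙X (f K.*ₚ g) ⟩
    (f K.*ₚ g) Self.⊙ K.X         ≈⟨ Self.⊙-* f g K.X ⟩
    f Self.⊙ (g Self.⊙ K.X)       ≈⟨ Self.⊙-cong (KX.refl {f}) (φ≈⊙X g) ⟨
    f Self.⊙ φ g                  ≈⟨ φ-∘ f (φ g) ⟨
    φ f ⊗ φ g                     ∎
    where open SetoidReasoning KX.setoid

  φ-1 : φ (K.const K.1#) K.≈ₚ K.X
  φ-1 = KX.trans (φ≈⊙X (K.const K.1#)) (Self.⊙-1 K.X)

  φ-∏ : ∀ {s} (S : Subset s) v → ⨂[ S ] (λ i → φ (v i)) K.≈ₚ φ (KR.∏[ S ] v)
  φ-∏ []            v = KX.sym φ-1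
  φ-∏ (inside  ∷ S) v = KX.trans
    (KR.∘-cong (KX.refl {φ (v zero)}) (φ-∏ S (v ∘ suc))) (KX.sym (φ-* (v zero) _))
  φ-∏ (outside ∷ S) v = φ-∏ S (v ∘ suc)

  ⟨⟩-φ : ∀ f β → φ f ⟨ β ⟩ L.≈ f ⊙ β
  ⟨⟩-φ = eval-spread

  ⟨⟩-cong : ∀ {M N} β → M K.≈ₚ N → M ⟨ β ⟩ L.≈ N ⟨ β ⟩
  ⟨⟩-cong β e = LR.eval-cong (map-cong e) LR.refl

  -- As q > 1, the exponents qⁱ increase strictly: the top term alone lands in degree qᵈ and nothing
  -- lands beyond it.
  φ-monic : ∀ {d} f → KR.HasDegreeMonic f d → K.Monic (φ f)
  φ-monic {d} f ((_ , f<) , fd≈1) = q ℕ.^ d ,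
    KR.hasDegreeMonic (φ f) above (KR.trans (KR.coeff-spread (q ℕ.^_) f d q^-injective) fd≈1)
    where
    q^-injective : ∀ i → q ℕ.^ i ≡ q ℕ.^ d → i ≡ d
    q^-injective i e with ℕ.<-cmp i d
    ... | tri< i<d _ _ = contradiction e (ℕ.<⇒≢ (ℕ.^-monoʳ-< q FK.1<q i<d))
    ... | tri≈ _ i≡d _ = i≡d
    ... | tri> _ _ d<i = contradiction e (ℕ.>⇒≢ (ℕ.^-monoʳ-< q FK.1<q d<i))

    above : KR.Below (suc (q ℕ.^ d)) (φ f)
    above j qᵈ<j = KR.coeff-spread-0 (q ℕ.^_) f λ i → bound i (ℕ.<-≤-connex d i)
      where
      bound : ∀ i → d < i ⊎ i ≤ d → K.coeff f i K.≈ K.0# ⊎ q ℕ.^ i ≢ j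
      bound i (inj₁ d<i) = inj₁ (f< i d<i)
      bound i (inj₂ i≤d) = inj₂ (ℕ.<⇒≢ (ℕ.≤-<-trans (ℕ.^-monoʳ-≤ q {{ℕ.>-nonZero (ℕ.<⇒≤ FK.1<q)}} i≤d) qᵈ<j))

  ⊙-∣ : ∀ {f g β} → f KX.∣ g → f ⊙ β L.≈ L.0# → g ⊙ β L.≈ L.0#
  ⊙-∣ {f} {g} {β} (h ,∣ hf≈g) fβ≈0 =
    L.trans (⊙-cong (KX.sym hf≈g) L.refl) (L.trans (⊙-* h f β) (⊙-zeroʳ h fβ≈0))

  product≡∏ : ∀ {s} (v : Vector K.Poly s) → K[x].product v ≡ KR.∏[ ⊤ ] v
  product≡∏ {zero}  v = ≡.refl
  product≡∏ {suc s} v = ≡.cong (v zero K.*ₚ_) (product≡∏ (v ∘ suc))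

  private
    1-_ : K.Poly → K.Poly
    1- f = K.const K.1# KX.- f

  ∏[1-]-⊙ : ∀ {s β} (v : Vector K.Poly s) → (∀ i → v i ⊙ β L.≈ L.0#) →
            (KR.∏[ ⊤ ] λ i → 1- v i) ⊙ β L.≈ β
  ∏[1-]-⊙ {zero}  {β} v vβ≈0 = ⊙-1 β
  ∏[1-]-⊙ {suc s} {β} v vβ≈0 = begin
    ((1- v zero) K.*ₚ w) ⊙ β                         ≈⟨ ⊙-* (1- v zero) w β ⟩
    (1- v zero) ⊙ w ⊙ β                              ≈⟨ ⊙-cong (KX.refl {1- v zero}) (∏[1-]-⊙ (v ∘ suc) (vβ≈0 ∘ suc)) ⟩
    (1- v zero) ⊙ β                                  ≈⟨ ⊙-+ (K.const K.1#) (KX.- v zero) β ⟩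
    K.const K.1# ⊙ β L.+ (KX.- v zero) ⊙ β           ≈⟨ LR.+-cong (⊙-1 β) (LR.trans (⊙-neg (v zero) β) (LR.-‿cong (vβ≈0 zero))) ⟩
    β L.- L.0#                                       ≈⟨ LR.trans (LR.+-congˡ (RingProperties.-0#≈0# LR.ring)) (LR.+-identityʳ β) ⟩
    β                                                ∎
    where
    open SetoidReasoning LR.setoid
    w = KR.∏[ ⊤ ] λ i → 1- v (suc i)

  hasDegreeMonic-∏ : ∀ {s} (S : Subset s) v d → (∀ i → KR.HasDegreeMonic (v i) (d i)) →
                     KR.HasDegreeMonic (KR.∏[ S ] v) (∑[ S ] d)
  hasDegreeMonic-∏ []            v d v-deg = KR.hasDegreeMonic-1
  hasDegreeMonic-∏ (inside  ∷ S) v d v-deg = KR.hasDegreeMonic-* (v zero) (KR.∏[ S ] (v ∘ suc))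
    (v-deg zero) (hasDegreeMonic-∏ S (v ∘ suc) (d ∘ suc) (v-deg ∘ suc))
  hasDegreeMonic-∏ (outside ∷ S) v d v-deg = hasDegreeMonic-∏ S (v ∘ suc) (d ∘ suc) (v-deg ∘ suc)

  -- Idempotents and comaximal factors of xⁿ - 1

  module _ {s} {𝐩 : Vector K.Poly s}
    (irreducible : ∀ i → K[x].Irreducible (𝐩 i))
    (factorisation : K.Xⁿ-1 (suc n) K.≈ₚ K[x].product 𝐩)
    {e : Vector K.Poly s} (e≡δ : ∀ i j → e i K.≡ K.δ i j [mod 𝐩 j ]) where

    open GroupProperties KX.+-group using (⁻¹-anti-homo-//; //-rightDividesˡ)

    δ-diagonal : ∀ i → K.δ {s} i i ≡ K.const K.1#
    δ-diagonal i rewrite dec-true (i Fin.≟ i) ≡.refl = ≡.refl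

    δ-off-diagonal : ∀ {i j} → i ≢ j → K.δ {s} i j ≡ []
    δ-off-diagonal {i} {j} i≢j rewrite dec-false (i Fin.≟ j) i≢j = ≡.refl

    𝐩∣1-e : ∀ i → 𝐩 i KX.∣ 1- e i
    𝐩∣1-e i with ≡.subst (λ d → 𝐩 i KX.∣ e i KX.- d) (δ-diagonal i) (e≡δ i i)
    ... | a ,∣ a𝐩≈e-1 = (KX.- a) ,∣ (begin
      (KX.- a) K.*ₚ 𝐩 i                ≈⟨ RingProperties.-‿distribˡ-* KX.ring a (𝐩 i) ⟨
      KX.- (a K.*ₚ 𝐩 i)                ≈⟨ KX.-‿cong a𝐩≈e-1 ⟩
      KX.- (e i KX.- K.const K.1#)     ≈⟨ ⁻¹-anti-homo-// (e i) (K.const K.1#) ⟩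
      1- e i                           ∎)
      where open SetoidReasoning KX.setoid

    𝐩∣e : ∀ {i j} → i ≢ j → 𝐩 j KX.∣ e i
    𝐩∣e {i} {j} i≢j = KX.∣-respʳ-≈ (KR.+ₚ-identityʳ (e i))
      (≡.subst (λ d → 𝐩 j KX.∣ e i KX.- d) (δ-off-diagonal i≢j) (e≡δ i j))

    comaximal : ∀ i j → i ≢ j → KR.Comaximal (𝐩 i) (𝐩 j)
    comaximal i j i≢j with 𝐩∣1-e i | 𝐩∣e i≢j
    ... | a ,∣ a𝐩≈1-e | b ,∣ b𝐩≈e =
      a , b , KX.trans (KX.+-cong a𝐩≈1-e b𝐩≈e) (//-rightDividesˡ (e i) (K.const K.1#))

    Xⁿ-1∣ : ∀ {f} → (∀ i → 𝐩 i KX.∣ f) → K.Xⁿ-1 (suc n) KX.∣ f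
    Xⁿ-1∣ 𝐩∣f = KX.∣-respˡ-≈
      (KX.sym (KX.trans factorisation (KX.reflexive (product≡∏ 𝐩))))
      (KR.∏-∣ ⊤ 𝐩 comaximal λ {i} _ → 𝐩∣f i)

    𝐩-e-⊙ : ∀ i β → 𝐩 i ⊙ e i ⊙ β L.≈ L.0#
    𝐩-e-⊙ i β = L.trans (L.sym (⊙-* (𝐩 i) (e i) β)) (⊙-∣ (Xⁿ-1∣ 𝐩∣𝐩e) (Xⁿ-1-⊙ β))
      where
      -- For j = i the factor `𝐩 i` supplies the divisibility, for j ≠ i the idempotent does.
      𝐩∣𝐩e : ∀ j → 𝐩 j KX.∣ 𝐩 i K.*ₚ e i
      𝐩∣𝐩e j with i Fin.≟ j
      ... | yes ≡.refl = e i ,∣ KX.*-comm (e i) (𝐩 i)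
      ... | no i≢j     = KX.x∣ʳy⇒x∣ʳzy (𝐩 i) (𝐩∣e i≢j)

    -- ∏ (1 - eᵢ) is divisible by every pⱼ, and fixes any β killed by all eᵢ.
    e-⊙-separates : ∀ {β} → (∀ i → e i ⊙ β L.≈ L.0#) → β L.≈ L.0#
    e-⊙-separates {β} eβ≈0 = L.trans (L.sym (∏[1-]-⊙ e eβ≈0))
      (⊙-∣ (Xⁿ-1∣ λ i → KX.∣-trans (𝐩∣1-e i) (KR.∈⇒∣∏ (λ i → 1- e i) ∈⊤)) (Xⁿ-1-⊙ β))

    -- The annihilator of α in K[x]

    module _ (α : L.Carrier) where

      open OrbitAnnihilator.Orbit L.commutativeRing FL.isDecidableField σ σ-hom n α (σⁿ≈id α)

      ∈Δ⇒ : ∀ {i} → i ∈ Δ e α → ¬ e i ⊙ α L.≈ L.0#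
      ∈Δ⇒ {i} i∈Δ eα≈0 with ≡.trans (≡.sym (Vec.[]=⇒lookup i∈Δ)) (≡.trans
        (Vec.lookup∘tabulate _ i)
        (dec-false (¬? (φ (e i) ⟨ α ⟩ L.≟ L.0#)) λ ¬0 → ¬0 (L.trans (⟨⟩-φ (e i) α) eα≈0)))
      ... | ()

      ⇒∈Δ : ∀ {i} → ¬ e i ⊙ α L.≈ L.0# → i ∈ Δ e α
      ⇒∈Δ {i} eα≉0 = Vec.lookup⇒[]= i (Δ e α) (≡.trans (Vec.lookup∘tabulate _ i)
        (dec-true (¬? (φ (e i) ⟨ α ⟩ L.≟ L.0#)) λ ≈0 → eα≉0 (L.trans (L.sym (⟨⟩-φ (e i) α)) ≈0)))

      minimal : K.Poly
      minimal = KR.∏[ Δ e α ] 𝐩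

      -- Vanishing is tested after applying each `e i`, which commutes with `minimal`: outside Δ the
      -- element `e i ⊙ α` is already 0, inside Δ the factor `𝐩 i` kills it.
      minimal-⊙ : minimal ⊙ α L.≈ L.0#
      minimal-⊙ = e-⊙-separates λ i → L.trans (⊙-*-comm (e i) minimal α) (case i (e i ⊙ α L.≟ L.0#))
        where
        case : ∀ i → Dec (e i ⊙ α L.≈ L.0#) → minimal ⊙ e i ⊙ α L.≈ L.0#
        case i (yes eα≈0) = ⊙-zeroʳ minimal eα≈0
        case i (no eα≉0)  = ⊙-∣ (KR.∈⇒∣∏ 𝐩 (⇒∈Δ eα≉0)) (𝐩-e-⊙ i α)

      minimal-∣ : ∀ {f} → f ⊙ α L.≈ L.0# → minimal KX.∣ f
      minimal-∣ {f} fα≈0 = KR.∏-∣ (Δ e α) 𝐩 comaximal 𝐩∣f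
        where
        𝐩∣f : ∀ {i} → i ∈ Δ e α → 𝐩 i KX.∣ f
        𝐩∣f {i} i∈Δ with KR.bezout (length f) (𝐩 i) f (KR.below-length f)
        ... | d , (u , v , d≈) , (w ,∣ wd≈𝐩) , d∣f
          with RawSemiringDefinitions.Irreducible.split-∣1 (irreducible i) (KX.sym wd≈𝐩)
        -- Here the cofactor `w` is a unit, so `𝐩 i` divides `d` and therefore `f`.
        ... | inj₁ (w′ ,∣ w′w≈1) = KX.∣-trans (w′ ,∣ (begin
            w′ K.*ₚ 𝐩 i            ≈⟨ KR.*ₚ-congˡ w′ wd≈𝐩 ⟨
            w′ K.*ₚ (w K.*ₚ d)     ≈⟨ KX.*-assoc w′ w d ⟨
            w′ K.*ₚ w K.*ₚ d       ≈⟨ KX.*-congʳ {d} w′w≈1 ⟩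
            K.const K.1# K.*ₚ d    ≈⟨ KX.*-identityˡ d ⟩
            d                      ∎)) d∣f
          where open SetoidReasoning KX.setoid
        -- Here `d` is a unit. As a combination of `𝐩 i` and `f` it kills `e i ⊙ α`, which would
        -- then be 0, against i ∈ Δ.
        ... | inj₂ d∣1 = contradiction (L.trans (L.sym (⊙-1 (e i ⊙ α))) (⊙-∣ d∣1 d-⊙)) (∈Δ⇒ i∈Δ)
          where
          open SetoidReasoning LR.setoid
          d-⊙ : d ⊙ e i ⊙ α L.≈ L.0#
          d-⊙ = begin
            d ⊙ e i ⊙ α                                      ≈⟨ ⊙-cong d≈ L.refl ⟩
            (u K.*ₚ 𝐩 i K.+ₚ v K.*ₚ f) ⊙ e i ⊙ α             ≈⟨ ⊙-+ (u K.*ₚ 𝐩 i) (v K.*ₚ f) _ ⟩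
            (u K.*ₚ 𝐩 i) ⊙ e i ⊙ α L.+ (v K.*ₚ f) ⊙ e i ⊙ α  ≈⟨ LR.+-cong
              (⊙-∣ (u ,∣ KX.refl) (𝐩-e-⊙ i α))
              (⊙-∣ (v ,∣ KX.refl) (L.trans (⊙-*-comm f (e i) α) (⊙-zeroʳ (e i) fα≈0))) ⟩
            L.0# L.+ L.0#                                    ≈⟨ LR.+-identityˡ _ ⟩
            L.0#                                             ∎

      -- The minimal q-polynomial of α

      private
        M : K.Poly
        M = ⨂[ Δ e α ] (λ i → φ (𝐩 i))

        M≈φ : M K.≈ₚ φ minimal
        M≈φ = φ-∏ (Δ e α) 𝐩

      isMinimalQPolynomial : ∀ {d} → KR.HasDegreeMonic minimal d → IsMinimalQPolynomial α M
      isMinimalQPolynomial deg = record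
        { monic       = monic-cong {φ minimal} {M} (KX.sym M≈φ) (φ-monic minimal deg)
        ; qPolynomial = minimal , M≈φ
        ; generates   = I⊆ , ⊆I
        }
        where
        monic-cong : ∀ {f g} → f K.≈ₚ g → K.Monic f → K.Monic g
        monic-cong e (d , degf , fd≈1) =
          d , KR.hasDegree-cong e degf , KR.trans (KR.sym (KR.coeff-≈ e d)) fd≈1

        I⊆ : ∀ {N} → N Unary.∈ I α → N Unary.∈ PrincipalIdeal M
        I⊆ {N} ((f , N≈φf) , Nα≈0) = quotient
          (minimal-∣ {f} (L.trans (L.sym (⟨⟩-φ f α)) (L.trans (L.sym (⟨⟩-cong {N} α N≈φf)) Nα≈0)))
          where
          open SetoidReasoning KX.setoid
          quotient : minimal KX.∣ f → N Unary.∈ PrincipalIdeal M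
          quotient (h ,∣ hm≈f) = φ h , (h , KX.refl) , (begin
            N                    ≈⟨ N≈φf ⟩
            φ f                  ≈⟨ φ-cong {h K.*ₚ minimal} {f} hm≈f ⟨
            φ (h K.*ₚ minimal)   ≈⟨ φ-* h minimal ⟩
            φ h ⊗ φ minimal      ≈⟨ KR.∘-cong (KX.refl {φ h}) M≈φ ⟨
            φ h ⊗ M              ∎)

        ⊆I : ∀ {N} → N Unary.∈ PrincipalIdeal M → N Unary.∈ I α
        ⊆I {N} (H , (h , H≈φh) , N≈HM) = (h K.*ₚ minimal , N≈φ) , (begin
            N ⟨ α ⟩                       ≈⟨ ⟨⟩-cong α N≈φ ⟩
            φ (h K.*ₚ minimal) ⟨ α ⟩      ≈⟨ ⟨⟩-φ (h K.*ₚ minimal) α ⟩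
            (h K.*ₚ minimal) ⊙ α          ≈⟨ ⊙-∣ {minimal} (h ,∣ KX.refl) minimal-⊙ ⟩
            L.0#                          ∎)
          where
          open SetoidReasoning LR.setoid
          N≈φ : N K.≈ₚ φ (h K.*ₚ minimal)
          N≈φ = KX.trans N≈HM (KX.trans (KR.∘-cong H≈φh M≈φ) (KX.sym (φ-* h minimal)))

      -- The gcd over L and k-normality

      ι-hasDegree : ∀ {d} f → K.HasDegree f d → L.HasDegree (List.map ι f) d
      ι-hasDegree {d} f (fd≉0 , f<) =
          (λ e → fd≉0 (injective (L.trans (L.sym (coeff-map f d)) (L.trans e (L.sym 0#-homo)))))
        , λ i d<i → L.trans (coeff-map f i) (L.trans (⟦⟧-cong (f< i d<i)) 0#-homo)

      ι-below⁻ : ∀ {f d} → LR.Below d (List.map ι f) → KR.Below d f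
      ι-below⁻ {f} f< i d≤i =
        injective (L.trans (L.sym (coeff-map f i)) (L.trans (f< i d≤i) (L.sym 0#-homo)))

      fixed⇒map-ι : ∀ r → Fixed r → ∃[ f ] List.map ι f L.≈ₚ r
      fixed⇒map-ι []      fix = [] , LX.refl
      fixed⇒map-ι (a ∷ r) fix with fixed⇒ι a (fix 0) | fixed⇒map-ι r (fix ∘ suc)
      ... | b , ιb≈a | f , ιf≈r = b ∷ f , LR.∷-cong ιb≈a ιf≈r

      g≈window : g (suc n) α L.≈ₚ window (orbit α) (suc n)
      g≈window = LX.trans (sum-monomials (λ i → α ^ᴸ (q ℕ.^ i)) (suc n))
        (window-cong (suc n) λ i _ → L.sym (σ^≈^ i α))

      module _ {d} (deg : KR.HasDegreeMonic minimal d) where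

        private
          m̂ : L.Poly
          m̂ = List.map ι minimal

          deg-m̂ : L.HasDegree m̂ d
          deg-m̂ = ι-hasDegree minimal (proj₁ deg)

          G : L.Poly
          G = window (orbit α) (suc n)

        -- Fixed coefficients come from K, so `r` is the image of some `f` that kills α. Then
        -- `minimal` divides `f`, whose degree is below d.
        fixed⇒0 : ∀ r → Fixed r → T r α L.≈ L.0# → LR.Below d r → r L.≈ₚ []
        fixed⇒0 r fix Trα≈0 r<d with fixed⇒map-ι r fix
        ... | f , ιf≈r with minimal-∣ (L.trans (T-cong ιf≈r L.refl) Trα≈0)
        ... | w ,∣ wm≈f = LX.trans (LX.sym ιf≈r) (map-cong (KX.trans (KX.sym wm≈f)
          (KX.*-congʳ {minimal} (KR.multiple-below w (proj₁ deg)
            (KR.below-cong (KX.sym wm≈f) (ι-below⁻ {f} (LR.below-cong (LX.sym ιf≈r) r<d)))))))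

        m̂-∣ : ∀ h → Annihilates h → m̂ LX.∣ h
        m̂-∣ = annihilates⇒multiple deg-m̂ (map-ψ-fixed minimal) minimal-⊙ fixed⇒0

        module _ {c k} (cm≈Xⁿ-1 : c K.*ₚ minimal K.≈ₚ K.Xⁿ-1 (suc n)) (degc : KR.HasDegreeMonic c k) where

          private
            ĉ : L.Poly
            ĉ = List.map ι c

            ĉm̂≈Xⁿ-1 : ĉ L.*ₚ m̂ L.≈ₚ L.Xⁿ-1 (suc n)
            ĉm̂≈Xⁿ-1 = LX.trans (LX.sym (map-* c minimal))
              (LX.trans (map-cong cm≈Xⁿ-1) (map-Xⁿ-1 (suc n)))

            Q̂ : L.Poly
            Q̂ = polynomialPart m̂ α

            m̂-annihilates : Annihilates m̂
            m̂-annihilates = annihilates-cong (LX.*-identityˡ m̂)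
              (annihilates-multiple LX.1# m̂ (map-ψ-fixed minimal) minimal-⊙)

            -- `m̂ *ₚ G` is `Q̂` times xⁿ⁺¹ - 1, that is, `Q̂ *ₚ ĉ *ₚ m̂`; cancelling `m̂` exhibits
            -- `Q̂` as the quotient of `G` by `ĉ`.
            ĉ∣g : ĉ LX.∣ g (suc n) α
            ĉ∣g = LX.∣-respʳ-≈ (LX.sym g≈window) (Q̂ ,∣ LR.*ₚ-cancelʳ (Q̂ L.*ₚ ĉ) G deg-m̂ (begin
              Q̂ L.*ₚ ĉ L.*ₚ m̂              ≈⟨ LX.*-assoc Q̂ ĉ m̂ ⟩
              Q̂ L.*ₚ (ĉ L.*ₚ m̂)            ≈⟨ LR.*ₚ-congˡ Q̂ ĉm̂≈Xⁿ-1 ⟩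
              Q̂ L.*ₚ L.Xⁿ-1 (suc n)        ≈⟨ annihilates⇒∣ m̂ m̂-annihilates ⟨
              m̂ L.*ₚ G                     ≈⟨ LX.*-comm m̂ G ⟩
              G L.*ₚ m̂                     ∎))
              where open SetoidReasoning LX.setoid

            -- If xⁿ - 1 = h′ h with h ∣ g, then xⁿ - 1 ∣ h′ g, so m̂ ∣ h′.
            ĉ-greatest : ∀ h → h LX.∣ g (suc n) α → h LX.∣ L.Xⁿ-1 (suc n) → h LX.∣ ĉ
            ĉ-greatest h (w ,∣ wh≈g) (h′ ,∣ h′h≈Xⁿ-1) = h∣ĉ (m̂-∣ h′ h′-annihilates)
              where
              open SetoidReasoning LX.setoid
              open CommutativeSemigroupProperties LX.*-commutativeSemigroup using (x∙yz≈y∙xz; xy∙z≈xz∙y)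

              wN≈h′G : w L.*ₚ L.Xⁿ-1 (suc n) L.≈ₚ h′ L.*ₚ G
              wN≈h′G = begin
                w L.*ₚ L.Xⁿ-1 (suc n)     ≈⟨ LR.*ₚ-congˡ w h′h≈Xⁿ-1 ⟨
                w L.*ₚ (h′ L.*ₚ h)        ≈⟨ x∙yz≈y∙xz w h′ h ⟩
                h′ L.*ₚ (w L.*ₚ h)        ≈⟨ LR.*ₚ-congˡ h′ (LX.trans wh≈g g≈window) ⟩
                h′ L.*ₚ G                 ∎

              h′-annihilates : Annihilates h′
              h′-annihilates = ∣⇒annihilates h′ w wN≈h′G

              h∣ĉ : m̂ LX.∣ h′ → h LX.∣ ĉ
              h∣ĉ (z ,∣ zm̂≈h′) = z ,∣ LR.*ₚ-cancelʳ (z L.*ₚ h) ĉ deg-m̂ (begin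
                z L.*ₚ h L.*ₚ m̂           ≈⟨ xy∙z≈xz∙y z h m̂ ⟩
                z L.*ₚ m̂ L.*ₚ h           ≈⟨ LX.*-congʳ {h} zm̂≈h′ ⟩
                h′ L.*ₚ h                 ≈⟨ h′h≈Xⁿ-1 ⟩
                L.Xⁿ-1 (suc n)            ≈⟨ ĉm̂≈Xⁿ-1 ⟨
                ĉ L.*ₚ m̂                  ∎)

          cofactor-isGCD : L.IsGCD (g (suc n) α) (L.Xⁿ-1 (suc n)) ĉ
          cofactor-isGCD = record
            { monic     = k , ι-hasDegree c (proj₁ degc) ,
                L.trans (coeff-map c k) (L.trans (⟦⟧-cong (proj₂ degc)) 1#-homo)
            ; divides₁  = ĉ∣g
            ; divides₂  = m̂ ,∣ LX.trans (LX.*-comm m̂ ĉ) ĉm̂≈Xⁿ-1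
            ; greatest  = ĉ-greatest
            }

      -- The quotient exists because xⁿ⁺¹ - 1 kills α. Comparing degrees and top coefficients in the
      -- product determines those of `c`.
      cofactor : ∀ {d} → KR.HasDegreeMonic minimal d → ∃₂ λ c k →
                 c K.*ₚ minimal K.≈ₚ K.Xⁿ-1 (suc n) × KR.HasDegreeMonic c k × k ℕ.+ d ≡ suc n
      cofactor {d} deg with minimal-∣ (Xⁿ-1-⊙ α)
      ... | c ,∣ cm≈Xⁿ-1 with KR.degree c
      ... | inj₁ c≈0 = contradiction
          (KR.trans (KR.coeff-≈ (KX.trans (KX.sym cm≈Xⁿ-1) (KX.*-congʳ {minimal} c≈0)) (suc n)) KR.refl)
          (proj₁ (proj₁ (KR.hasDegreeMonic-Xⁿ-1 n)))
      ... | inj₂ (k , degc) = c , k , cm≈Xⁿ-1 , (degc , ck≈1) , k+d≡n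
        where
        k+d≡n : k ℕ.+ d ≡ suc n
        k+d≡n = KR.hasDegree-unique (K.Xⁿ-1 (suc n)) (KR.hasDegree-cong cm≈Xⁿ-1 (KR.hasDegree-* c minimal degc (proj₁ deg)))
          (proj₁ (KR.hasDegreeMonic-Xⁿ-1 n))

        ck≈1 : K.coeff c k K.≈ K.1#
        ck≈1 = begin
          K.coeff c k                                ≈⟨ KR.*-identityʳ _ ⟨
          K.coeff c k K.* K.1#                       ≈⟨ KR.*-congˡ (proj₂ deg) ⟨
          K.coeff c k K.* K.coeff minimal d          ≈⟨ proj₁ (KR.top-* c minimal (proj₂ degc) (proj₂ (proj₁ deg))) ⟨
          K.coeff (c K.*ₚ minimal) (k ℕ.+ d)         ≈⟨ KR.coeff-≈ cm≈Xⁿ-1 (k ℕ.+ d) ⟩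
          K.coeff (K.Xⁿ-1 (suc n)) (k ℕ.+ d)         ≡⟨ ≡.cong (K.coeff (K.Xⁿ-1 (suc n))) k+d≡n ⟩
          K.coeff (K.Xⁿ-1 (suc n)) (suc n)           ≈⟨ proj₂ (KR.hasDegreeMonic-Xⁿ-1 n) ⟩
          K.1#                                       ∎
          where open SetoidReasoning KR.setoid

      -- The equation k + d = n + 1 in the naturals is what makes the integer difference a natural
      -- number.
      isNormal : ∀ {d} → KR.HasDegreeMonic minimal d → ¬ α L.≈ L.0# →
                 ∃[ k ] (+ k ≡ + suc n ℤ.- + d × IsNormal (suc n) k α)
      isNormal {d} deg α≉0 with cofactor deg
      ... | c , k , cm≈Xⁿ-1 , degc , k+d≡n = k , k≡n-d d k+d≡n , record
          { nonzero    = α≉0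
          ; k<n        = k<n d deg k+d≡n
          ; gcd-degree = List.map ι c , cofactor-isGCD deg cm≈Xⁿ-1 degc , ι-hasDegree c (proj₁ degc)
          }
        where
        k≡n-d : ∀ d → k ℕ.+ d ≡ suc n → + k ≡ + suc n ℤ.- + d
        k≡n-d d k+d≡n = ≡.trans (≡.sym (//-rightDividesʳ (+ d) (+ k))) (≡.cong (λ n → + n ℤ.- + d) k+d≡n)
          where open GroupProperties (AbelianGroup.group ℤ.+-0-abelianGroup) using (//-rightDividesʳ)

        k<n : ∀ d → KR.HasDegreeMonic minimal d → k ℕ.+ d ≡ suc n → k < suc n
        -- If d were 0, the monic `minimal` would be the constant 1, which kills α only when α = 0.
        k<n zero    ((_ , m<) , m₀≈1) _ = contradiction
          (L.trans (L.sym (⊙-1 α)) (L.trans (⊙-cong (KX.sym m≈1) L.refl) minimal-⊙)) α≉0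
          where
          m≈1 : minimal K.≈ₚ K.const K.1#
          m≈1 = K.mk≈ₚ λ { zero → m₀≈1 ; (suc i) → m< (suc i) (s≤s z≤n) }
        k<n (suc d) _ k+d≡n = ≡.subst (k <_) k+d≡n (ℕ.m<m+n k (s≤s z≤n))

-- Minimal q-polynomials and k-normal elements

open import Data.Integer.Base using (+_; _-_)
open import Data.Nat.Base using (_^_)
open import Data.Nat.GCD using (gcd)

theorem2p3 : ∀ {c ℓ₁ ℓ₂ c′ ℓ₁′ ℓ₂′} (p m q n Q : ℕ) →
    Prime p → 1 ≤ m → q ≡ p ^ m → 1 ≤ n → gcd n p ≡ 1 → Q ≡ q ^ n →
    (K : FiniteField c ℓ₁ ℓ₂ q) (L : FiniteField c′ ℓ₁′ ℓ₂′ Q) (E : FieldExtension K L) →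
    let open Extension E in
    (s : ℕ) (𝐩 : Vector K.Poly s) (deg : Vector ℕ s) →
    (∀ i → K.Monic (𝐩 i)) →
    (∀ i → K[x].Irreducible (𝐩 i)) →
    (∀ i j → i ≢ j → ¬ 𝐩 i K.≈ₚ 𝐩 j) →
    K.Xⁿ-1 n K.≈ₚ K[x].product 𝐩 →
    (∀ i → K.HasDegree (𝐩 i) (deg i)) →
    (e : Vector K.Poly s) →
    (∀ i j → e i K.≡ K.δ i j [mod 𝐩 j ]) →
    (α : L.Carrier) → ¬ α L.≈ L.0# →
    IsMinimalQPolynomial α (⨂[ Δ e α ] (λ i → φ (𝐩 i)))
    × ∃[ k ] (+ k ≡ + n - + (∑[ Δ e α ] deg) × IsNormal n k α)
theorem2p3 p m q (suc n) Q p-prime _ q≡pᵐ _ _ Q≡qⁿ K L E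
           s 𝐩 deg 𝐩-monic irreducible _ factorisation 𝐩-deg e e≡δ α α≉0 =
    isMinimalQPolynomial irreducible factorisation e≡δ α minimal-deg
  , isNormal irreducible factorisation e≡δ α minimal-deg α≉0
  where
  -- After the match on `suc n`, the parameter `n` is one less than the degree of the extension.
  open ConjugateAnnihilation {m = m} {n = n} p-prime q≡pᵐ Q≡qⁿ E
  open Extension E
  open FieldPolynomials K.commutativeRing (FiniteFieldProperties.isDecidableField K)

  𝐩-degMonic : ∀ i → HasDegreeMonic (𝐩 i) (deg i)
  -- The degree inside `Monic` is existential; uniqueness of degrees identifies it with `deg i`.
  𝐩-degMonic i with 𝐩-monic i
  ... | d , degd , lead≈1 with hasDegree-unique (𝐩 i) degd (𝐩-deg i)
  ... | ≡.refl = degd , lead≈1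

  minimal-deg : HasDegreeMonic (minimal irreducible factorisation e≡δ α) (∑[ Δ e α ] deg)
  minimal-deg = hasDegreeMonic-∏ (Δ e α) 𝐩 deg 𝐩-degMonic
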